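{- Let $\mathcal{O}=(Q,\{Q_p\mid p\in\mathcal{P}\},\delta_0,\delta_{>0})$ be a one-counter process with $|Q|=k$, let $K=\mathrm{LCM}(\{1,\dots,k\})$, and for a $\mathsf{CTL}$ formula $\varphi$ let $K_\varphi=K^{\mathrm{lud}(\varphi)}$. Then for every $\mathsf{CTL}$ formula $\varphi$ one can compute in polynomial time a threshold $$t(\varphi)\ \leq\ 2\cdot|\varphi|\cdot k^2\cdot K_\varphi$$ such that for all $n,n'>t(\varphi)$ with $n\equiv n' \pmod{K_\varphi}$ and every control location $q\in Q$ we have $$(q,n)\in[\![\varphi]\!]_{T(\mathcal{O})}\iff (q,n')\in[\![\varphi]\!]_{T(\mathcal{O})}.$$
   Context: Fix a countable set $\mathcal{P}$ of atomic propositions. A one-counter process (OCP) is a tuple $\mathcal{O}=(Q,\{Q_p\mid p\in\mathcal{P}\},\delta_0,\delta_{>0})$ where $Q$ is a finite set of control locations, $Q_p\subseteq Q$ for each $p$ with $Q_p=\emptyset$ for all but finitely many $p$, $\delta_0\subseteq Q\times\{0,1\}\times Q$ (zero transitions) and $\delta_{>0}\subseteq Q\times\{ -1,0,1\}\times Q$ (positive transitions). It defines the transition system $T(\mathcal{O})$ with state set $Q\times\mathbb{N}$, where state $(q,n)$ satisfies proposition $p$ iff $q\in Q_p$, and $(q,n)\to(q',n+k)$ iff either $n=0$ and $(q,k,q')\in\delta_0$, or $n>0$ and $(q,k,q')\in\delta_{>0}$. $\mathsf{CTL}$ formulas are given by $\varphi::=p\mid\neg\varphi\mid\varphi\wedge\varphi\mid\exists\mathsf{X}\varphi\mid\exists\varphi\,\mathsf{U}\,\varphi\mid\exists\varphi\,\mathsf{WU}\,\varphi$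 ($p\in\mathcal{P}$), with the standard semantics $[\![\varphi]\!]_T\subseteq S$ over a transition system $T$ with state set $S$: $[\![\exists\mathsf{X}\varphi]\!]$ is the set of states having a successor in $[\![\varphi]\!]$; $[\![\exists\varphi_1\mathsf{U}\varphi_2]\!]$ is the set of states $s$ from which there is a finite path $s=\pi_1\to\cdots\to\pi_\ell$ ($\ell\ge1$) with $\pi_\ell\in[\![\varphi_2]\!]$ and $\pi_i\in[\![\varphi_1]\!]$ for all $i<\ell$; $[\![\exists\varphi_1\mathsf{WU}\varphi_2]\!]$ is $[\![\exists\varphi_1\mathsf{U}\varphi_2]\!]$ together with the states from which some infinite path has all its states in $[\![\varphi_1]\!]$. Size: $|p|=1$, $|\neg\varphi|=|\exists\mathsf{X}\varphi|=|\varphi|+1$, $|\varphi_1\wedge\varphi_2|=|\exists\varphi_1\mathsf{U}\varphi_2|=|\exists\varphi_1\mathsf{WU}\varphi_2|=|\varphi_1|+|\varphi_2|+1$. The leftward until depth $\mathrm{lud}$ is defined by $\mathrm{lud}(p)=0$, $\mathrm{lud}(\neg\varphi)=\mathrm{lud}(\exists\mathsf{X}\varphi)=\mathrm{lud}(\varphi)$, $\mathrm{lud}(\varphi_1\wedge\varphi_2)=\max\{\mathrm{lud}(\varphi_1),\mathrm{lud}(\varphi_2)\}$, and $\mathrm{lud}(\exists\varphi_1\mathsf{U}\varphi_2)=\mathrm{lud}(\exists\varphi_1\mathsf{WU}\varphi_2)=\max\{\mathrm{lud}(\varphi_1)+1,\mathrm{lud}(\varphi_2)\}$. $\mathrm{LCM}(M)$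 is the least common multiple of a finite nonempty set $M$ of positive integers. -}

module Defs where

open import Data.Bool.Base using (Bool; true; false; if_then_else_)
open import Data.Digit using (Bit; 0b; 1b; Expansion; toDigits; fromDigits)
open import Data.Fin.Base using (Fin; zero; suc; inject₁; fromℕ)
open import Data.Fin.Subset as Subset using (Subset)
open import Data.Integer.Base as ℤ using (ℤ; +_; -[1+_])
open import Data.List.Base using (List; []; _∷_; _++_; [_]; length; map; foldr; concatMap; replicate; upTo; allFin; head; drop)
open import Data.List.Membership.Propositional using () renaming (_∉_ to _∉ˡ_)
open import Data.Maybe.Base using (Maybe)
open import Data.Nat.Base using (ℕ; zero; suc; _+_; _*_; _^_; _≤_; _<_; _⊔_; ∣_-_∣)
open import Data.Nat.Divisibility using (_∣_)
open import Data.Nat.LCM using (lcm)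
open import Data.Product.Base using (Σ; ∃; ∃-syntax; _×_; _,_; proj₁)
open import Data.Sum.Base using (_⊎_)
open import Data.Vec.Base as Vec using (Vec; _[_]%=_)
open import Function.Bundles using (_↣_; module Injection)
open import Level using (0ℓ)
open import Relation.Binary.Core using (Rel)
open import Relation.Binary.PropositionalEquality.Core using (_≡_)
open import Relation.Nullary.Negation.Core using (¬_)
open import Relation.Unary using (Pred)

------------------------------------------------------------------------
-- Transition systems and CTL

record TransitionSystem (P : Set) : Set₁ where
  infix 4 _⟶_
  field
    State : Set
    Sat   : P → Pred State 0ℓ
    _⟶_   : Rel State 0ℓ

infix  9 EX_ ¬′_
infixr 7 _∧′_
infix  8 E_U_ E_WU_

data CTL (P : Set) : Set where
  atom   : P → CTL P
  ¬′_    : CTL P → CTL P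
  _∧′_   : CTL P → CTL P → CTL P
  EX_    : CTL P → CTL P
  E_U_   : CTL P → CTL P → CTL P
  E_WU_  : CTL P → CTL P → CTL P

module Semantics {P : Set} (𝒯 : TransitionSystem P) where
  open TransitionSystem 𝒯

  FinitePath : Pred State 0ℓ → Pred State 0ℓ → Pred State 0ℓ
  FinitePath A B s =
    ∃[ ℓ ] Σ (Fin (suc ℓ) → State) λ π →
      π zero ≡ s ×
      (∀ (i : Fin ℓ) → π (inject₁ i) ⟶ π (suc i)) ×
      (∀ (i : Fin ℓ) → A (π (inject₁ i))) ×
      B (π (fromℕ ℓ))

  InfinitePath : Pred State 0ℓ → Pred State 0ℓ
  InfinitePath A s =
    Σ (ℕ → State) λ π →
      π 0 ≡ s ×
      (∀ i → π i ⟶ π (suc i)) ×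
      (∀ i → A (π i))

  ⟦_⟧ : CTL P → Pred State 0ℓ
  ⟦ atom p ⟧   s = Sat p s
  ⟦ ¬′ φ ⟧     s = ¬ ⟦ φ ⟧ s
  ⟦ φ ∧′ ψ ⟧   s = ⟦ φ ⟧ s × ⟦ ψ ⟧ s
  ⟦ EX φ ⟧     s = ∃[ s′ ] (s ⟶ s′) × ⟦ φ ⟧ s′
  ⟦ E φ U ψ ⟧  s = FinitePath ⟦ φ ⟧ ⟦ ψ ⟧ s
  ⟦ E φ WU ψ ⟧ s = FinitePath ⟦ φ ⟧ ⟦ ψ ⟧ s ⊎ InfinitePath ⟦ φ ⟧ s

open Semantics public using () renaming (⟦_⟧ to ⟦_⟧-in)

size : ∀ {P} → CTL P → ℕ
size (atom p)   = 1
size (¬′ φ)     = size φ + 1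
size (φ ∧′ ψ)   = size φ + size ψ + 1
size (EX φ)     = size φ + 1
size (E φ U ψ)  = size φ + size ψ + 1
size (E φ WU ψ) = size φ + size ψ + 1

lud : ∀ {P} → CTL P → ℕ
lud (atom p)   = 0
lud (¬′ φ)     = lud φ
lud (φ ∧′ ψ)   = lud φ ⊔ lud ψ
lud (EX φ)     = lud φ
lud (E φ U ψ)  = (lud φ + 1) ⊔ lud ψ
lud (E φ WU ψ) = (lud φ + 1) ⊔ lud ψ

------------------------------------------------------------------------
-- One-counter processes

data Change₀ : Set where
  stay up : Change₀

data Change₊ : Set where
  down stay up : Change₊

value₀ : Change₀ → ℤ
value₀ stay = + 0
value₀ up   = + 1

value₊ : Change₊ → ℤ
value₊ down = -[1+ 0 ]
value₊ stay = + 0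
value₊ up   = + 1

-- A transition relation R ⊆ Q × D × Q is given by its successor sets:
-- (q , d , q′) ∈ R  iff  q′ ∈ δ q d.

record OCP (P : Set) : Set where
  field
    k  : ℕ

  Q : Set
  Q = Fin k

  field
    label   : P → Subset k
    support : List P
    finite  : ∀ p → p ∉ˡ support → label p ≡ Subset.⊥
    δ₀      : Q → Change₀ → Subset k
    δ₊      : Q → Change₊ → Subset k

  Configuration : Set
  Configuration = Q × ℕ

  infix 4 _⟶_
  _⟶_ : Rel Configuration 0ℓ
  (q , n) ⟶ (q′ , n′) =
    (n ≡ 0 × ∃[ d ] q′ Subset.∈ δ₀ q d × + n′ ≡ + n ℤ.+ value₀ d) ⊎
    (0 < n × ∃[ d ] q′ Subset.∈ δ₊ q d × + n′ ≡ + n ℤ.+ value₊ d)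

T : ∀ {P} → OCP P → TransitionSystem P
T 𝒪 = record
  { State = Configuration
  ; Sat   = λ p (q , n) → q Subset.∈ label p
  ; _⟶_   = _⟶_
  } where open OCP 𝒪

------------------------------------------------------------------------
-- The period

-- Only applied to lists of positive numbers; the value at [] is 1.
LCM : List ℕ → ℕ
LCM = foldr lcm 1

period : ∀ {P} → OCP P → CTL P → ℕ
period 𝒪 φ = LCM (map suc (upTo (OCP.k 𝒪))) ^ lud φ

infix 4 _≡_[mod_]
_≡_[mod_] : ℕ → ℕ → ℕ → Set
m ≡ n [mod d ] = d ∣ ∣ m - n ∣

------------------------------------------------------------------------
-- Polynomial-time computation
--
-- The machine model is structured programs acting on a fixed number of
-- stacks over a finite alphabet.  A primitive step inspects or changes
-- the top of one stack only, so a multitape Turing machine (one tape per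
-- stack) simulates a program with constant overhead per step; conversely
-- a tape is a pair of stacks.

data Symbol : Set where
  bit                 : Bit → Symbol
  # $                 : Symbol
  at not and ex eu ew : Symbol

data Program (r : ℕ) : Set where
  skip   : Program r
  push   : Fin r → Symbol → Program r
  pop    : Fin r → Program r
  _⨾_    : Program r → Program r → Program r
  branch : Fin r → (Maybe Symbol → Program r) → Program r
  while  : Fin r → (Maybe Symbol → Bool) → Program r → Program r

Stacks : ℕ → Set
Stacks r = Vec (List Symbol) r

top : ∀ {r} → Fin r → Stacks r → Maybe Symbol
top i σ = head (Vec.lookup σ i)

-- ⟨ c , σ ⟩⇓[ n ] τ : started in σ, the program c halts in τ after n steps.

infix 4 ⟨_,_⟩⇓[_]_

data ⟨_,_⟩⇓[_]_ {r : ℕ} : Program r → Stacks r → ℕ → Stacks r → Set where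
  skip        : ∀ {σ} → ⟨ skip , σ ⟩⇓[ 1 ] σ
  push        : ∀ {σ i a} → ⟨ push i a , σ ⟩⇓[ 1 ] (σ [ i ]%= (a ∷_))
  pop         : ∀ {σ i} → ⟨ pop i , σ ⟩⇓[ 1 ] (σ [ i ]%= drop 1)
  _⨾_         : ∀ {c d σ τ υ m n} →
                ⟨ c , σ ⟩⇓[ m ] τ → ⟨ d , τ ⟩⇓[ n ] υ →
                ⟨ c ⨾ d , σ ⟩⇓[ m + n ] υ
  branch      : ∀ {i f σ τ n} →
                ⟨ f (top i σ) , σ ⟩⇓[ n ] τ →
                ⟨ branch i f , σ ⟩⇓[ suc n ] τ
  while-false : ∀ {i b c σ} →
                b (top i σ) ≡ false →
                ⟨ while i b c , σ ⟩⇓[ 1 ] σ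
  while-true  : ∀ {i b c σ τ υ m n} →
                b (top i σ) ≡ true →
                ⟨ c , σ ⟩⇓[ m ] τ → ⟨ while i b c , τ ⟩⇓[ n ] υ →
                ⟨ while i b c , σ ⟩⇓[ suc (m + n) ] υ

-- The input is placed on stack 0.  The result, read from stack 0, is in
-- binary with the least significant bit on top; leading zeros are allowed.

PolynomialTime : {A : Set} → (A → List Symbol) → (A → ℕ) → Set
PolynomialTime {A} encode f =
  ∃[ r ] Σ (Program (suc r)) λ c → ∃[ a ] ∃[ e ] ∀ (x : A) →
    ∃[ n ] Σ (Stacks (suc r)) λ τ → Σ (Expansion 2) λ ds →
      ⟨ c , encode x Vec.∷ Vec.replicate r [] ⟩⇓[ n ] τ ×
      n ≤ a * length (encode x) ^ e + a ×
      Vec.head τ ≡ map bit ds ×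
      fromDigits ds ≡ f x

-- The number of control locations is written in unary, which is
-- polynomially related to the size of the transition tables that follow;
-- names of atomic propositions are written in binary.

module Encoding {P : Set} (countable : P ↣ ℕ) where

  name : P → List Symbol
  name p = map bit (proj₁ (toDigits 2 (Injection.to countable p))) ++ [ # ]

  subset : ∀ {k} → Subset k → List Symbol
  subset S = map (λ b → bit (if b then 1b else 0b)) (Vec.toList S)

  ocp : OCP P → List Symbol
  ocp 𝒪 =
    replicate k (bit 1b) ++ [ # ] ++
    concatMap (λ q → subset (δ₀ q stay) ++ subset (δ₀ q up)) (allFin k) ++
    concatMap (λ q → subset (δ₊ q down) ++ subset (δ₊ q stay) ++ subset (δ₊ q up)) (allFin k) ++
    concatMap (λ p → name p ++ subset (label p)) support ++
    [ $ ]
    where open OCP 𝒪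

  -- Prefix notation.
  ctl : CTL P → List Symbol
  ctl (atom p)   = at ∷ name p
  ctl (¬′ φ)     = not ∷ ctl φ
  ctl (φ ∧′ ψ)   = and ∷ ctl φ ++ ctl ψ
  ctl (EX φ)     = ex ∷ ctl φ
  ctl (E φ U ψ)  = eu ∷ ctl φ ++ ctl ψ
  ctl (E φ WU ψ) = ew ∷ ctl φ ++ ctl ψ

  instance-of : OCP P × CTL P → List Symbol
  instance-of (𝒪 , φ) = ocp 𝒪 ++ ctl φ

{-# OPTIONS --safe #-}
module Submission where

-- The threshold is the bound 2 ∣φ∣ k² K_φ itself.
--
-- Periodicity is shown by induction on φ; the interesting case is φ U ψ.  Let p be the
-- period of φ and P = e p that of φ U ψ, so that 1, …, k divide e.  A path that stays
-- sufficiently high can be shifted by P as a whole.  Otherwise it descends through at least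
-- k² e consecutive levels that are p apart, and the control locations in which these levels
-- are first reached form a path of a relation on k points that does not depend on the level.
-- Every k steps of that path contain a cycle of some length j ≤ k.  Repeating one cycle e / j
-- times lengthens the descent by P; among the k e cycles found in disjoint segments some
-- length j occurs e / j times, and removing these shortens it by P.
--
-- The threshold is computed in binary by multiplications with factors in unary.  The least
-- common multiple of 1, …, k is the product of the numbers mᵢ, where mᵢ is the least m > 0
-- such that i divides m m₁ ⋯ mᵢ₋₁; finding mᵢ needs m₁ ⋯ mᵢ₋₁ only modulo i.

open import Defs
open import Data.Bool.Base using (Bool; true; false; if_then_else_)
open import Data.Digit using (0b; 1b; Expansion; toDigits; fromDigits)
open import Data.Fin.Base as Fin using (Fin; zero; suc; toℕ)
import Data.Fin.Properties as Fin
open import Data.Integer.Base as ℤ using () renaming (+_ to pos)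
import Data.Integer.Properties as ℤ
open import Data.List.Base
  using (List; []; _∷_; _++_; _ʳ++_; length; map; replicate; head; drop; foldr; concatMap; upTo; allFin)
open import Data.List.Membership.Propositional using (_∈_)
open import Data.List.Membership.Propositional.Properties using (∈-map⁺; ∈-upTo⁺)
open import Data.List.Properties
  using (length-map; length-++; length-ʳ++; map-++; ++-identityʳ; ++-assoc; ++-ʳ++; ʳ++-ʳ++; upTo-∷ʳ)
open import Data.List.Relation.Unary.All as All using (All; []; _∷_)
import Data.List.Relation.Unary.All.Properties as All
open import Data.List.Relation.Unary.Any using (here; there)
open import Data.Maybe.Base using (Maybe; just; nothing)
open import Data.Nat.Base
open import Data.Nat.DivMod
open import Data.Nat.Divisibility
open import Data.Nat.Induction using (Acc; acc; <-wellFounded)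
open import Data.Nat.LCM using (lcm; m∣lcm[m,n]; n∣lcm[m,n]; lcm-least)
open import Data.Nat.ListAction using (product)
open import Data.Nat.Properties
open import Data.Nat.Tactic.RingSolver using (solve-∀)
open import Data.Product.Base as Product
  using (Σ; ∃; ∃-syntax; _×_; _,_; proj₁; proj₂; map₁; map₂; uncurry)
open import Data.Sum.Base using (_⊎_; inj₁; inj₂; [_,_]′)
open import Data.Vec.Base as Vec using (Vec; []; _∷_; _[_]%=_)
import Data.Vec.Properties as Vec
open import Function.Base using (_∘_; id; const)
open import Function.Bundles using (_↣_; _⇔_; mk⇔; module Equivalence; module Injection)
import Function.Properties.Equivalence as ⇔
open import Level using (0ℓ)
open import Relation.Binary.Core using (Rel)
open import Relation.Binary.Construct.Closure.ReflexiveTransitive using (Star; ε; _◅_; _◅◅_; gmap)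
open import Relation.Binary.Definitions using (tri<; tri≈; tri>)
open import Relation.Binary.PropositionalEquality
  using (_≡_; _≢_; refl; sym; trans; cong; cong₂; subst; subst₂; module ≡-Reasoning)
open import Relation.Nullary using (¬_; yes; no; contradiction)
open import Relation.Nullary.Decidable using (False; toWitnessFalse)
open import Relation.Unary using (Pred)

open Equivalence using (to; from)

-- Cycles in paths through a finite set

-- Only the left argument of an until raises the period. The cycles that are inserted or removed
-- shift parts of a descent by multiples of `p`, not of `e * p`. The left formula has to hold along
-- the way and must therefore have period `p`; the factor `e` is the price for obtaining one fixed
-- total shift from cycles of unpredictable lengths. The right formula matters only at the end,
-- whose level is either unchanged or shifted by `e * p`, so it may already have the full period.
-- This is the asymmetry in `lud`. Since an equivalence is claimed, descents must be shortened as
-- well as lengthened. Lengthening is cheap, one cycle suffices; shortening uses up many cycles of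
-- equal length and is what forces the k² in the bound. The bound depends on φ only through its size
-- and its depth, so thresholds of subformulas are never computed: it is enough to count nodes and
-- to take a maximum of depths. What remains difficult is that K can be exponential in k, so that it
-- is available in binary or as a list of factors, but not in unary.

data Iter {A : Set} (R : Rel A 0ℓ) : ℕ → Rel A 0ℓ where
  []  : ∀ {x} → Iter R 0 x x
  _∷_ : ∀ {m x y z} → R x y → Iter R m y z → Iter R (suc m) x z

module _ {A : Set} {R : Rel A 0ℓ} where

  infixr 5 _++ᵢ_
  _++ᵢ_ : ∀ {m n x y z} → Iter R m x y → Iter R n y z → Iter R (m + n) x z
  []      ++ᵢ v = v
  (r ∷ u) ++ᵢ v = r ∷ (u ++ᵢ v)

  splitᵢ : ∀ m {n x z} → Iter R (m + n) x z → ∃[ y ] Iter R m x y × Iter R n y z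
  splitᵢ zero    w       = _ , [] , w
  splitᵢ (suc m) (r ∷ w) with _ , u , v ← splitᵢ m w = _ , r ∷ u , v

  repeatᵢ : ∀ {m x} n → Iter R m x x → Iter R (n * m) x x
  repeatᵢ zero    w = []
  repeatᵢ (suc n) w = w ++ᵢ repeatᵢ n w

  visit : ∀ {m x y} → Iter R m x y → Fin (suc m) → A
  visit {x = x} w       zero    = x
  visit         (_ ∷ w) (suc i) = visit w i

  cut : ∀ {m x y} (w : Iter R m x y) i →
        ∃[ n ] toℕ i + n ≡ m × Iter R (toℕ i) x (visit w i) × Iter R n (visit w i) y
  cut w       zero    = _ , refl , [] , w
  cut (r ∷ w) (suc i) with n , eq , u , v ← cut w i = n , cong suc eq , r ∷ u , v

  Lasso : ℕ → Rel A 0ℓ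
  Lasso m x y = ∃[ z ] ∃[ a ] ∃[ d ] ∃[ c ]
    a + suc d + c ≡ m × Iter R a x z × Iter R (suc d) z z × Iter R c z y

  revisit : ∀ {m x y} (w : Iter R m x y) i j → i Fin.< j → visit w i ≡ visit w j → Lasso m x y
  revisit (r ∷ w) zero (suc j) _ eq with n , eq′ , u , v ← cut w j =
    _ , 0 , toℕ j , n , cong suc eq′ , [] ,
    subst (Iter R _ _) (sym eq) (r ∷ u) , subst (λ z → Iter R _ z _) (sym eq) v
  revisit (r ∷ w) (suc i) (suc j) i<j eq
    with z , a , d , c , eq′ , u , l , v ← revisit w i j (s≤s⁻¹ i<j) eq =
    z , suc a , d , c , cong suc eq′ , r ∷ u , l , v

module _ {k : ℕ} {R : Rel (Fin k) 0ℓ} where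

  lasso : ∀ {x y} → Iter R k x y → Lasso {R = R} k x y
  lasso w with i , j , i<j , eq ← Fin.pigeonhole ≤-refl (visit w) = revisit w i j i<j eq

  grow : ∀ {e m x y} → (∀ j → suc j ≤ k → suc j ∣ e) → k ≤ m → Iter R m x y → Iter R (m + e) x y
  grow {e} {m} {x} {y} ∣e k≤m w
    with l , refl ← m≤n⇒∃[o]m+o≡n k≤m
    -- Looking for the cycle among the first `k` steps only bounds its length by `k`, so that the
    -- length divides `e`.
    with _ , u , v ← splitᵢ k w
    with z , a , d , c , refl , s , t , s′ ← lasso u
    with divides q refl ← ∣e d (≤-trans (m≤n+m (suc d) a) (m≤m+n (a + suc d) c)) =
    subst (λ n → Iter R n x y) (rearrange a (suc d) c l (q * suc d))
      ((s ++ᵢ t ++ᵢ repeatᵢ q t ++ᵢ s′) ++ᵢ v)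
    where
    rearrange : ∀ a d c l e → a + (d + (e + c)) + l ≡ a + d + c + l + e
    rearrange = solve-∀

  -- The length of the removed cycle, less one, is returned as an element of `Fin k` so that it can
  -- index the vector of demands below.
  shorten : ∀ {x y} → Iter R k x y → ∃[ j ] ∃[ r ] r + suc (toℕ j) ≡ k × Iter R r x y
  shorten w with z , a , d , c , eq , s , t , s′ ← lasso w =
    Fin.fromℕ< d<k , a + c ,
    trans (cong (λ n → a + c + suc n) (Fin.toℕ-fromℕ< d<k)) (trans (rearrange a c (suc d)) eq) ,
    s ++ᵢ s′
    where
    d<k = subst (d <_) eq (≤-trans (m≤n+m (suc d) a) (m≤m+n (a + suc d) c))
    rearrange : ∀ a c d → a + c + d ≡ a + d + c
    rearrange = solve-∀

sum-decrement : ∀ {k} (d : Vec ℕ k) j {n} → Vec.lookup d j ≡ suc n →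
                suc (Vec.sum (d [ j ]%= pred)) ≡ Vec.sum d
sum-decrement (m ∷ d) zero    refl = refl
sum-decrement (m ∷ d) (suc j) eq   =
  trans (sym (+-suc m _)) (cong (m +_) (sum-decrement d j eq))

module _ {k : ℕ} {R : Rel (Fin k) 0ℓ} where

  -- d j + 1 cycles of length j + 1 are still to be found.
  shorten-demand : ∀ N (d : Vec ℕ k) → Vec.sum d < N → ∀ {x y} → Iter R (N * k) x y →
    ∃[ j ] ∃[ r ] r + suc (Vec.lookup d j) * suc (toℕ j) ≡ N * k × Iter R r x y
  shorten-demand (suc N) d d<N w
    with _ , u , v ← splitᵢ k w
    with j , r , eq , u′ ← shorten u
    with Vec.lookup d j in dj
  -- One cycle of this length was still missing and has just been found: the length wins, and the
  -- rest of the path stays uncut.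
  ... | zero  = j , r + N * k ,
    trans (cong (λ n → r + N * k + suc n * suc (toℕ j)) dj)
      (trans (rearrange r (N * k) _) (cong (_+ N * k) eq)) ,
    u′ ++ᵢ v
    where
    rearrange : ∀ r n j → r + n + 1 * j ≡ r + j + n
    rearrange = solve-∀
  ... | suc n
    with j′ , r′ , eq′ , v′ ← shorten-demand N (d [ j ]%= pred)
                                (subst (_≤ N) (sym (sum-decrement d j dj)) (s≤s⁻¹ d<N)) v
    -- Whether the present segment is cut is settled only now, when the recursion has returned the
    -- winning length: its cycle goes if it has that length and stays otherwise.
    with j′ Fin.≟ j
  ... | yes refl = j , r + r′ , (begin
        r + r′ + suc (Vec.lookup d j) * J                          ≡⟨ cong (λ n → r + r′ + suc n * J) dj ⟩
        r + r′ + suc (suc n) * J                                   ≡⟨ rearrange r r′ n J ⟩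
        (r + J) + (r′ + suc n * J)                                 ≡⟨ cong (λ m → r + J + (r′ + suc m * J))
                                                                        (sym (trans (Vec.lookup∘updateAt j d) (cong pred dj))) ⟩
        (r + J) + (r′ + suc (Vec.lookup (d [ j ]%= pred) j) * J)   ≡⟨ cong₂ _+_ eq eq′ ⟩
        k + N * k                                                  ∎) , u′ ++ᵢ v′
    where
    open ≡-Reasoning
    J = suc (toℕ j)
    rearrange : ∀ r r′ n j → r + r′ + suc (suc n) * j ≡ (r + j) + (r′ + suc n * j)
    rearrange = solve-∀
  ... | no j′≢j = j′ , k + r′ , (begin
        k + r′ + suc (Vec.lookup d j′) * J                          ≡⟨ +-assoc k r′ _ ⟩
        k + (r′ + suc (Vec.lookup d j′) * J)                        ≡⟨ cong (λ m → k + (r′ + suc m * J))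
                                                                          (sym (Vec.lookup∘updateAt′ j′ j j′≢j d)) ⟩
        k + (r′ + suc (Vec.lookup (d [ j ]%= pred) j′) * J)         ≡⟨ cong (k +_) eq′ ⟩
        k + N * k                                                   ∎) , u ++ᵢ v′
    where
    open ≡-Reasoning
    J = suc (toℕ j′)

sum-tabulate-≤ : ∀ {k} (f : Fin k → ℕ) {b} → (∀ j → f j ≤ b) → Vec.sum (Vec.tabulate f) ≤ k * b
sum-tabulate-≤ {zero}  f f≤b = z≤n
sum-tabulate-≤ {suc k} f f≤b = +-mono-≤ (f≤b zero) (sum-tabulate-≤ (λ j → f (suc j)) (λ j → f≤b (suc j)))

module _ {k : ℕ} {R : Rel (Fin k) 0ℓ} where

  shrink : ∀ {e m x y} .{{_ : NonZero e}} → (∀ j → suc j ≤ k → suc j ∣ e) → k * e * k ≤ m →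
           Iter R m x y → ∃[ r ] r + e ≡ m × Iter R r x y
  shrink {suc e} {m} {x} {y} ∣e b≤m w with l , refl ← m≤n⇒∃[o]m+o≡n b≤m =
    r + l , trans (rearrange r l (suc e)) (cong (_+ l) (trans (cong (r +_) (sym (demand-met j))) (proj₁ shorter))) ,
    proj₂ shorter ++ᵢ proj₂ (proj₂ parts)
    where
    rearrange : ∀ r l e → r + l + e ≡ r + e + l
    rearrange = solve-∀
    -- The predecessor compensates for `shorten-demand`, which delivers one cycle more than the
    -- demand.
    demand : Fin k → ℕ
    demand j = pred (quotient (∣e (toℕ j) (Fin.toℕ<n j)))
    demand-exact : ∀ {j} (j∣ : suc j ∣ suc e) → suc (pred (quotient j∣)) * suc j ≡ suc e
    demand-exact (divides (suc q) eq) = sym eq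
    demand-met : ∀ j → suc (Vec.lookup (Vec.tabulate demand) j) * suc (toℕ j) ≡ suc e
    demand-met j = trans (cong (λ n → suc n * suc (toℕ j)) (Vec.lookup∘tabulate demand j))
      (demand-exact (∣e (toℕ j) (Fin.toℕ<n j)))
    demand≤ : ∀ j → demand j ≤ e
    demand≤ j = s≤s⁻¹ (subst (suc (demand j) ≤_) (demand-exact (∣e (toℕ j) (Fin.toℕ<n j)))
      (m≤m*n (suc (demand j)) (suc (toℕ j))))
    -- The `k` demands are at most `e` each, while there are `k * suc e` segments; the inequality is
    -- strict because `x` makes `k` nonzero.
    demand< : Vec.sum (Vec.tabulate demand) < k * suc e
    demand< = ≤-<-trans (sum-tabulate-≤ demand demand≤) (*-monoʳ-< k {{Fin.nonZeroIndex x}} (n<1+n e))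
    parts : ∃[ z ] Iter R (k * suc e * k) x z × Iter R l z y
    parts = splitᵢ (k * suc e * k) w
    shortened = shorten-demand (k * suc e) (Vec.tabulate demand) demand< (proj₁ (proj₂ parts))
    j = proj₁ shortened
    r = proj₁ (proj₂ shortened)
    shorter = proj₂ (proj₂ shortened)

-- Walks of one-counter processes

data Chain (f : ℕ → ℕ) : ℕ → ℕ → Set where
  end  : ∀ {i} → Chain f 0 i
  link : ∀ {m i j} → i < j → f i ≤ f j → Chain f m j → Chain f (suc m) i

module _ {f : ℕ → ℕ} where

  -- No minimum of `f` is searched for: if the shorter chain found to the right starts at a smaller
  -- value, the search restarts there, and the value can drop only finitely often.
  chain : ∀ m i → ∃[ j ] i ≤ j × Chain f m j
  chain zero    i = i , ≤-refl , end
  chain (suc m) i = search i (<-wellFounded (f i))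
    where
    search : ∀ i → Acc _<_ (f i) → ∃[ j ] i ≤ j × Chain f (suc m) j
    search i (acc rec) with j , i<j , c ← chain m (suc i) with f i ≤? f j
    ... | yes fi≤fj = i , ≤-refl , link i<j fi≤fj c
    ... | no  fi≰fj = map₂ (map₁ (≤-trans (<⇒≤ i<j))) (search j (rec (≰⇒> fi≰fj)))

  index : ∀ {m i} → Chain f m i → Fin (suc m) → ℕ
  index {i = i} c            zero    = i
  index         (link _ _ c) (suc a) = index c a

  index-mono : ∀ {m i} (c : Chain f m i) {a b} → a Fin.< b →
               index c a < index c b × f (index c a) ≤ f (index c b)
  index-mono (link i<j fi≤fj c) {zero}  {suc zero}    _   = i<j , fi≤fj
  index-mono (link i<j fi≤fj c) {zero}  {suc (suc b)} _
    with j<b , fj≤fb ← index-mono c {zero} {suc b} z<s = <-trans i<j j<b , ≤-trans fi≤fj fj≤fb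
  index-mono (link i<j fi≤fj c) {suc a} {suc b}       a<b = index-mono c (s≤s⁻¹ a<b)

  -- A chain with `m` links has one index more than there are colours. The colours will be control
  -- locations paired with residues of the counter.
  recurrence : ∀ {m} (g : ℕ → Fin m) → ∃[ i ] ∃[ j ] i < j × g i ≡ g j × f i ≤ f j
  recurrence {m} g with _ , _ , c ← chain m 0
    with a , b , a<b , eq ← Fin.pigeonhole ≤-refl (g ∘ index c)
    with i<j , fi≤fj ← index-mono c a<b = _ , _ , i<j , eq , fi≤fj

%≡%⇒≡+ : ∀ {m n} p .{{_ : NonZero p}} → m ≤ n → m % p ≡ n % p → ∃[ c ] n ≡ m + c * p
%≡%⇒≡+ {m} {n} p m≤n eq with c , m/p+c≡n/p ← m≤n⇒∃[o]m+o≡n (/-monoˡ-≤ p m≤n) = c , (begin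
  n                                ≡⟨ m≡m%n+[m/n]*n n p ⟩
  n % p + n / p * p                ≡⟨ cong₂ (λ r q → r + q * p) (sym eq) (sym m/p+c≡n/p) ⟩
  m % p + (m / p + c) * p          ≡⟨ rearrange (m % p) (m / p) c p ⟩
  m % p + m / p * p + c * p        ≡⟨ cong (_+ c * p) (sym (m≡m%n+[m/n]*n m p)) ⟩
  m + c * p                        ∎)
  where
  open ≡-Reasoning
  rearrange : ∀ r q c p → r + (q + c) * p ≡ r + q * p + c * p
  rearrange = solve-∀

module _ {P : Set} (𝒪 : OCP P) where
  open OCP 𝒪
  open Semantics (T 𝒪)

  translate : ∀ {q q′ n n′} s → 0 < n → (q , n) ⟶ (q′ , n′) → (q , n + s) ⟶ (q′ , n′ + s)
  translate s n>0 (inj₁ (refl , _)) = contradiction n>0 λ ()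
  translate {n = n} s n>0 (inj₂ (_ , d , q′∈ , eq)) = inj₂ (≤-trans n>0 (m≤m+n n s) , d , q′∈ , (begin
    pos _ ℤ.+ pos s                 ≡⟨ cong (ℤ._+ pos s) eq ⟩
    pos n ℤ.+ value₊ d ℤ.+ pos s    ≡⟨ ℤ.+-assoc (pos n) (value₊ d) (pos s) ⟩
    pos n ℤ.+ (value₊ d ℤ.+ pos s)  ≡⟨ cong (λ x → pos n ℤ.+ x) (ℤ.+-comm (value₊ d) (pos s)) ⟩
    pos n ℤ.+ (pos s ℤ.+ value₊ d)  ≡⟨ sym (ℤ.+-assoc (pos n) (pos s) (value₊ d)) ⟩
    pos n ℤ.+ pos s ℤ.+ value₊ d    ∎))
    where open ≡-Reasoning

  untranslate : ∀ {q q′ n m} s → 0 < n → (q , n + s) ⟶ (q′ , m) →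
                ∃[ n′ ] m ≡ n′ + s × (q , n) ⟶ (q′ , n′)
  untranslate {n = suc n} s _ (inj₂ (_ , down , q′∈ , eq)) =
    n , ℤ.+-injective eq , inj₂ (z<s , down , q′∈ , refl)
  untranslate {n = suc n} s _ (inj₂ (_ , stay , q′∈ , eq)) =
    suc n + 0 , trans (ℤ.+-injective eq) (rearrange (suc n) s) , inj₂ (z<s , stay , q′∈ , refl)
    where
    rearrange : ∀ n s → n + s + 0 ≡ n + 0 + s
    rearrange = solve-∀
  untranslate {n = suc n} s _ (inj₂ (_ , up , q′∈ , eq)) =
    suc n + 1 , trans (ℤ.+-injective eq) (rearrange (suc n) s) , inj₂ (z<s , up , q′∈ , refl)
    where
    rearrange : ∀ n s → n + s + 1 ≡ n + 1 + s
    rearrange = solve-∀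

  ⟶-level : ∀ {q q′ n n′} → (q , n) ⟶ (q′ , n′) → n ≤ suc n′
  ⟶-level (inj₁ (refl , _)) = z≤n
  ⟶-level {n = suc n} (inj₂ (_ , down , _ , eq)) = s≤s (≤-reflexive (sym (ℤ.+-injective eq)))
  ⟶-level {n = suc n} (inj₂ (_ , stay , _ , eq)) =
    m≤n⇒m≤1+n (≤-trans (m≤m+n (suc n) 0) (≤-reflexive (sym (ℤ.+-injective eq))))
  ⟶-level {n = suc n} (inj₂ (_ , up , _ , eq)) =
    m≤n⇒m≤1+n (≤-trans (m≤m+n (suc n) 1) (≤-reflexive (sym (ℤ.+-injective eq))))

  -- The predicate is asked of the source of each step only. So the last configuration of a walk is
  -- free, as in the semantics of until; in particular a walk above level `b` may end at `b`.
  Step Walk : Pred Configuration 0ℓ → Rel Configuration 0ℓ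
  Step A s s′ = A s × s ⟶ s′
  Walk A = Star (Step A)

  Above : ℕ → Pred Configuration 0ℓ → Pred Configuration 0ℓ
  Above b A s = b < proj₂ s × A s

  relax : ∀ {A B s s′} → (∀ {t} → A t → B t) → Walk A s s′ → Walk B s s′
  relax A⊆B = gmap id (map₁ A⊆B)

  recast : ∀ {A b b′ q n n′ q₁ n₁ n₁′} → b ≡ b′ → n ≡ n′ → n₁ ≡ n₁′ →
           Walk (Above b A) (q , n) (q₁ , n₁) → Walk (Above b′ A) (q , n′) (q₁ , n₁′)
  recast refl refl refl w = w

  finite⇒walk : ∀ {A B s} → FinitePath A B s → ∃[ s′ ] Walk A s s′ × B s′
  finite⇒walk {A} (ℓ , π , refl , steps , as , b) = _ , walk ℓ π steps as , b
    where
    walk : ∀ ℓ (π : Fin (suc ℓ) → Configuration) → (∀ i → π (Fin.inject₁ i) ⟶ π (suc i)) →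
           (∀ i → A (π (Fin.inject₁ i))) → Walk A (π zero) (π (Fin.fromℕ ℓ))
    walk zero    π steps as = ε
    walk (suc ℓ) π steps as = (as zero , steps zero) ◅ walk ℓ (π ∘ suc) (steps ∘ suc) (as ∘ suc)

  walk⇒finite : ∀ {A B s s′} → Walk A s s′ → B s′ → FinitePath A B s
  walk⇒finite {s = s} ε b = 0 , (λ _ → s) , refl , (λ ()) , (λ ()) , b
  walk⇒finite {s = s} ((a , s⟶) ◅ w) b with ℓ , π , refl , steps , as , b′ ← walk⇒finite w b =
    suc ℓ , (λ { zero → s ; (suc i) → π i }) , refl ,
    (λ { zero → s⟶ ; (suc i) → steps i }) , (λ { zero → a ; (suc i) → as i }) , b′

  prefix : ∀ {A} (π : ℕ → Configuration) → (∀ i → π i ⟶ π (suc i)) → (∀ i → A (π i)) →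
           ∀ {i j} → i ≤′ j → Walk A (π i) (π j)
  prefix π steps as ≤′-refl       = ε
  prefix π steps as (≤′-step i≤j) = prefix π steps as i≤j ◅◅ ((as _ , steps _) ◅ ε)

  prepend : ∀ {A s s′} → Walk A s s′ → InfinitePath A s′ → InfinitePath A s
  prepend ε π = π
  prepend {s = s} ((a , s⟶) ◅ w) inf with π , refl , steps , as ← prepend w inf =
    (λ { zero → s ; (suc i) → π i }) , refl , (λ { zero → s⟶ ; (suc i) → steps i }) ,
    (λ { zero → a ; (suc i) → as i })

  module _ {A : Pred Configuration 0ℓ} (Live : Pred Configuration 0ℓ)
           (next : ∀ {s} → Live s → ∃[ s′ ] Step A s s′ × Live s′) where

    infinite : ∀ {s} → Live s → InfinitePath A s
    infinite {s} live = proj₁ ∘ run , refl ,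
      (λ i → proj₂ (proj₁ (proj₂ (next (proj₂ (run i)))))) ,
      (λ i → proj₁ (proj₁ (proj₂ (next (proj₂ (run i))))))
      where
      run : ℕ → ∃ Live
      run zero    = s , live
      run (suc i) = _ , proj₂ (proj₂ (next (proj₂ (run i))))

  -- A step lowers the counter by at most one, so a walk that does not stay above `b` meets the
  -- level `b` exactly.
  first-hit : ∀ {A b q n s} → b < n → Walk A (q , n) s →
              (Walk (Above b A) (q , n) s × b < proj₂ s) ⊎
              (∃[ q′ ] Walk (Above b A) (q , n) (q′ , b) × Walk A (q′ , b) s)
  -- The first step is kept visible because a loop must be nonempty to be iterated into an infinite
  -- path.
  first-hit⁺ : ∀ {A b q n s₁ s} → b < n → Step A (q , n) s₁ → Walk A s₁ s →
               (∃[ s₁ ] Step (Above b A) (q , n) s₁ × Walk (Above b A) s₁ s × b < proj₂ s) ⊎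
               (∃[ q′ ] Walk (Above b A) (q , n) (q′ , b) × Walk A (q′ , b) s)
  first-hit b<n ε          = inj₁ (ε , b<n)
  first-hit b<n (step ◅ w) with first-hit⁺ b<n step w
  ... | inj₁ (_ , step′ , w′ , b<) = inj₁ (step′ ◅ w′ , b<)
  ... | inj₂ hit                   = inj₂ hit
  first-hit⁺ {b = b} {s₁ = q₁ , n₁} b<n (a , s⟶) w with <-cmp b n₁
  ... | tri> _ _ n₁<b = contradiction (≤-trans b<n (⟶-level s⟶)) (<⇒≱ (s≤s n₁<b))
  ... | tri≈ _ refl _ = inj₂ (q₁ , ((b<n , a) , s⟶) ◅ ε , w)
  ... | tri< b<n₁ _ _ with first-hit b<n₁ w
  ...   | inj₁ (w′ , b<)      = inj₁ (_ , ((b<n , a) , s⟶) , w′ , b<)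
  ...   | inj₂ (q′ , w′ , w″) = inj₂ (q′ , ((b<n , a) , s⟶) ◅ w′ , w″)

  -- Predicates periodic in the counter and the shifting of walks

  Periodic : ℕ → ℕ → Pred Configuration 0ℓ → Set
  Periodic t p A = ∀ q n → t < n → A (q , n) ⇔ A (q , n + p)

  periodic-raise : ∀ {t t′ p A} → t ≤ t′ → Periodic t p A → Periodic t′ p A
  periodic-raise t≤t′ per q n t′<n = per q n (≤-<-trans t≤t′ t′<n)

  periodic-* : ∀ {t p A} c → Periodic t p A → Periodic t (c * p) A
  periodic-* {A = A} zero per q n t<n =
    mk⇔ (subst (λ m → A (q , m)) (sym (+-identityʳ n))) (subst (λ m → A (q , m)) (+-identityʳ n))
  periodic-* {p = p} {A} (suc c) per q n t<n = mk⇔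
    (subst (λ m → A (q , m)) (+-assoc n p (c * p)) ∘ to far ∘ to near)
    (from near ∘ from far ∘ subst (λ m → A (q , m)) (sym (+-assoc n p (c * p))))
    where
    near = per q n t<n
    far  = periodic-* {A = A} c per q (n + p) (≤-trans t<n (m≤m+n n p))

  module _ {t s A} (per : Periodic t s A) where

    shift-step : ∀ {b q n q′ n′} → t ≤ b → Step (Above b A) (q , n) (q′ , n′) →
                 Step (Above (b + s) A) (q , n + s) (q′ , n′ + s)
    shift-step t≤b ((b<n , a) , s⟶) =
      (+-monoˡ-< s b<n , to (per _ _ (≤-<-trans t≤b b<n)) a) , translate s (≤-<-trans z≤n b<n) s⟶

    shift-up : ∀ {b q n q′ n′} → t ≤ b → Walk (Above b A) (q , n) (q′ , n′) →
               Walk (Above (b + s) A) (q , n + s) (q′ , n′ + s)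
    shift-up t≤b ε          = ε
    shift-up t≤b (step ◅ w) = shift-step t≤b step ◅ shift-up t≤b w

    shift-down : ∀ {b q n q′ m} → t ≤ b → Walk (Above (b + s) A) (q , n + s) (q′ , m) →
                 ∃[ n′ ] m ≡ n′ + s × Walk (Above b A) (q , n) (q′ , n′)
    shift-down t≤b ε = _ , refl , ε
    shift-down {b} {n = n} t≤b (((b<n , a) , s⟶) ◅ w)
      with b<n′ ← +-cancelʳ-< s b n b<n
      with n₁ , refl , s⟶′ ← untranslate s (≤-<-trans z≤n b<n′) s⟶
      with n′ , eq , w′ ← shift-down t≤b w =
      n′ , eq , ((b<n′ , from (per _ _ (≤-<-trans t≤b b<n′)) a) , s⟶′) ◅ w′

    shift-infinite-up : ∀ {b q n} → t ≤ b → InfinitePath (Above b A) (q , n) → InfinitePath A (q , n + s)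
    shift-infinite-up t≤b (π , refl , steps , as) =
      map₂ (_+ s) ∘ π , refl ,
      (λ i → translate s (≤-<-trans z≤n (proj₁ (as i))) (steps i)) ,
      (λ i → to (per _ _ (≤-<-trans t≤b (proj₁ (as i)))) (proj₂ (as i)))

    shift-infinite-down : ∀ {q n} → InfinitePath (Above (t + s) A) (q , n + s) → InfinitePath A (q , n)
    shift-infinite-down {n = n} (π , eq , steps , as) =
      -- The truncated subtraction is exact, since all levels on the path exceed `t + s`.
      map₂ (_∸ s) ∘ π , trans (cong (map₂ (_∸ s)) eq) (cong (_ ,_) (m+n∸n≡m n s)) ,
      step ,
      (λ i → from (per _ _ (t< i)) (subst (λ m → A (proj₁ (π i) , m)) (sym (restore i)) (proj₂ (as i))))
      where
      t< : ∀ i → t < proj₂ (π i) ∸ s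
      t< i = m+n≤o⇒m≤o∸n (suc t) (proj₁ (as i))
      restore : ∀ i → proj₂ (π i) ∸ s + s ≡ proj₂ (π i)
      restore i = m∸n+n≡m (≤-trans (m≤n+m s (suc t)) (proj₁ (as i)))
      step : ∀ i → map₂ (_∸ s) (π i) ⟶ map₂ (_∸ s) (π (suc i))
      step i with n′ , eq , s⟶ ← untranslate s (≤-<-trans z≤n (t< i))
                    (subst (λ m → (proj₁ (π i) , m) ⟶ π (suc i)) (sym (restore i)) (steps i)) =
        subst (λ m → _ ⟶ (_ , m)) (sym (trans (cong (_∸ s) eq) (m+n∸n≡m n′ s))) s⟶

  module _ {t p A} .{{_ : NonZero p}} (per : Periodic t p A) where

    module _ {q d b n} (t≤b : t ≤ b)
             {s₁} (start : Step (Above b A) (q , n) s₁) (loop : Walk (Above b A) s₁ (q , n + d * p)) where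

      private
        Live : Pred Configuration 0ℓ
        Live s = ∃[ c ] Walk (Above b A) s (q , n + c * (d * p))

        turn : ∀ c → ∃[ s′ ] Step (Above b A) (q , n + c * (d * p)) s′ × Live s′
        turn c = _ , map₁ higher (shift-step shifted t≤b start) ,
          suc c , recast refl refl (+-assoc n (d * p) (c * (d * p)))
                    (relax higher (shift-up shifted t≤b loop))
          where
          shifted = periodic-* {A = A} c (periodic-* {A = A} d per)
          higher : ∀ {s} → Above (b + c * (d * p)) A s → Above b A s
          higher = map₁ (≤-<-trans (m≤m+n b _))

        next : ∀ {s} → Live s → ∃[ s′ ] Step (Above b A) s s′ × Live s′
        next (c , ε)        = turn c
        next (c , step ◅ w) = _ , step , c , w

      -- The loop may gain height: each turn replays it `d * p` higher than the turn before.
      -- Periodicity of `A` permits this, and raising a walk keeps it above `b`.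
      cycle-forever : InfinitePath (Above b A) (q , n)
      cycle-forever = infinite Live next
        (0 , subst (λ m → Walk (Above b A) (q , n) (q , m)) (sym (+-identityʳ n)) ε)

    -- Whether an infinite path ever reaches level b is undecidable, but an
    -- initial segment of it either reaches b or can be closed to a lasso above b.
    infinite-hit : ∀ {b q n} → t ≤ b → b < n → InfinitePath A (q , n) →
                   InfinitePath (Above b A) (q , n) ⊎
                   (∃[ q′ ] Walk (Above b A) (q , n) (q′ , b) × InfinitePath A (q′ , b))
    infinite-hit {b} t≤b b<n (π , refl , steps , as)
      -- The two positions agree in control location and in level modulo `p`, and the later level is
      -- not lower, so the segment between them is a loop that gains a multiple of `p`.
      with i , j , i<j , same , ni≤nj ← recurrence {f = λ i → proj₂ (π i)}
             (λ i → Fin.combine (proj₁ (π i)) (proj₂ (π i) mod p))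
      with first-hit b<n (prefix π steps as {0} {i} (≤⇒≤′ z≤n))
    ... | inj₂ (q′ , w , w′) = inj₂ (q′ , w , prepend w′ (π ∘ (_+ i) , refl , steps ∘ (_+ i) , as ∘ (_+ i)))
    ... | inj₁ (w , b<ni)
      with first-hit⁺ b<ni (as i , steps i) (prefix π steps as (≤⇒≤′ i<j))
    ...   | inj₂ (q′ , w₁ , w₂) = inj₂ (q′ , w ◅◅ w₁ , prepend w₂ (π ∘ (_+ j) , refl , steps ∘ (_+ j) , as ∘ (_+ j)))
    ...   | inj₁ (_ , step , w₁ , _)
      with q≡ , r≡ ← Fin.combine-injective _ _ _ _ same
      with d , nj≡ ← %≡%⇒≡+ p ni≤nj (trans (sym (Fin.toℕ-fromℕ< (m%n<n (proj₂ (π i)) p)))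
                       (trans (cong toℕ r≡) (Fin.toℕ-fromℕ< (m%n<n (proj₂ (π j)) p)))) =
      inj₁ (prepend w (cycle-forever {d = d} t≤b step (subst (Walk (Above b A) _) (cong₂ _,_ (sym q≡) nj≡) w₁)))

    -- Lengthening and shortening of descents

    module _ {e} .{{_ : NonZero e}} (∣e : ∀ j → suc j ≤ k → suc j ∣ e) {b} (t≤b : t ≤ b) where

      private
        -- The segments between successive levels are all brought down to the same base `l` by
        -- multiples of `p`. There they become steps of one relation and can be repeated, removed
        -- and joined freely.
        Drop : ℕ → Rel Q 0ℓ
        Drop l q q′ = Walk (Above l A) (q , p + l) (q′ , l)

        multiple : ∀ c → Periodic t (c * p) A
        multiple c = periodic-* {A = A} c per

        rearrange : ∀ p l m → p + l + m ≡ p + m + l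
        rearrange = solve-∀

        rise : ∀ {l m q q′} → t ≤ l → Iter (Drop l) m q q′ → Walk (Above l A) (q , m * p + l) (q′ , l)
        rise t≤l [] = ε
        rise {l} {suc m} t≤l (drop ∷ w) =
          recast refl (rearrange p l (m * p)) (+-comm l (m * p))
            (relax (map₁ (≤-<-trans (m≤m+n l (m * p)))) (shift-up (multiple m) t≤l drop))
          ◅◅ rise t≤l w

        descend : ∀ {l} m {q q′} → t ≤ l → Walk (Above l A) (q , m * p + l) (q′ , l) → Iter (Drop l) m q q′
        descend zero t≤l ε = []
        descend zero t≤l (((l<l , _) , _) ◅ _) = contradiction l<l (<-irrefl refl)
        descend {l} (suc m) t≤l w with first-hit {b = m * p + l} (+-monoˡ-< l (m<n+m (m * p) (>-nonZero⁻¹ p))) w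
        ... | inj₁ (_ , m*p+l<l) = contradiction (m≤n+m l (m * p)) (<⇒≱ m*p+l<l)
        ... | inj₂ (_ , w₁ , w₂)
          with _ , eq , w₁′ ← shift-down (multiple m) {b = l} {n = p + l} t≤l
                 (recast (+-comm (m * p) l) (rearrange p (m * p) l) refl
                   (relax (map₂ proj₂) w₁))
          with refl ← +-cancelʳ-≡ (m * p) l _ (trans (+-comm l (m * p)) eq) =
          w₁′ ∷ descend m t≤l w₂

      descent : ∀ {q q′ n} → b + k * e * k * p ≤ n → Walk (Above b A) (q , n) (q′ , b) →
                Walk A (q , n + e * p) (q′ , b) ×
                (∃[ n′ ] n ≡ n′ + e * p × Walk A (q , n′) (q′ , b))
      descent {q} {q′} b+B≤n w
        with d , refl ← m≤n⇒∃[o]m+o≡n (≤-trans (m≤m+n b _) b+B≤n) =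
        [ (λ (_ , l<b) → contradiction (m≤n+m b (d % p)) (<⇒≱ l<b)) , rebuild ]′
          (first-hit (subst (l <_) (sym level) (m<n+m l (*-mono-< {0} {m} {0} {p} 0<m (>-nonZero⁻¹ p)))) w)
        where
        instance
          k≢0 : NonZero k
          k≢0 = Fin.nonZeroIndex q
        -- The remainder modulo `p` is left below the base `l`, so that the height above it is
        -- exactly `m * p`.
        l = d % p + b
        m = d / p
        t≤l = ≤-trans t≤b (m≤n+m b (d % p))
        level : b + d ≡ m * p + l
        level = trans (cong (λ d → b + d) (m≡m%n+[m/n]*n d p)) (rotate b (d % p) (m * p))
          where
          rotate : ∀ b r x → b + (r + x) ≡ x + (r + b)
          rotate = solve-∀
        kek≤m : k * e * k ≤ m
        kek≤m = ≤-trans (≤-reflexive (sym (m*n/n≡m (k * e * k) p))) (/-monoˡ-≤ p (+-cancelˡ-≤ b _ _ b+B≤n))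
        k≤m : k ≤ m
        k≤m = ≤-trans (m≤n*m k (k * e) {{m*n≢0 k e}}) kek≤m
        0<m : 0 < m
        0<m = ≤-trans (>-nonZero⁻¹ k) k≤m
        rebuild : (∃[ q″ ] Walk (Above l (Above b A)) (q , b + d) (q″ , l) × Walk (Above b A) (q″ , l) (q′ , b)) →
                  Walk A (q , b + d + e * p) (q′ , b) ×
                  (∃[ n′ ] b + d ≡ n′ + e * p × Walk A (q , n′) (q′ , b))
        rebuild (q″ , w₁ , w₂) =
          subst (λ n → Walk A (q , n) (q′ , b)) longer (onward (grow ∣e k≤m drops)) ,
          r * p + l , shorter , onward (proj₂ (proj₂ shrunk))
          where
          drops : Iter (Drop l) m q q″
          drops = descend m t≤l (subst (λ n → Walk (Above l A) (q , n) (q″ , l)) level (relax (map₂ proj₂) w₁))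
          shrunk = shrink ∣e kek≤m drops
          r = proj₁ shrunk
          onward : ∀ {m} → Iter (Drop l) m q q″ → Walk A (q , m * p + l) (q′ , b)
          onward i = relax proj₂ (rise t≤l i) ◅◅ relax proj₂ w₂
          unfold : ∀ r e p l → (r + e) * p + l ≡ r * p + l + e * p
          unfold = solve-∀
          longer : (m + e) * p + l ≡ b + d + e * p
          longer = trans (unfold m e p l) (cong (_+ e * p) (sym level))
          shorter : b + d ≡ r * p + l + e * p
          shorter = trans level (trans (cong (λ m → m * p + l) (sym (proj₁ (proj₂ shrunk)))) (unfold r e p l))

  -- Periodicity of until and weak until

  module _ {t p A} .{{_ : NonZero p}} (per : Periodic t p A)
           {e} .{{_ : NonZero e}} (∣e : ∀ j → suc j ≤ k → suc j ∣ e) where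

    private
      -- With the margin `e * p`, a walk that stays above `b` is still above `t` after it has been
      -- shifted down by one period.
      b = t + e * p
      t≤b = m≤m+n t (e * p)
      b<_ : ∀ {n} → b + k * e * k * p < n → b < n
      b<_ = ≤-<-trans (m≤m+n b _)
      multiple = periodic-* {A = A} e per

      reroute-up : ∀ {q q′ n} → b + k * e * k * p < n →
        Walk (Above b A) (q , n) (q′ , b) → Walk A (q , n + e * p) (q′ , b)
      reroute-up far w = proj₁ (descent per ∣e t≤b (<⇒≤ far) w)

      reroute-down : ∀ {q q′ n} → b + k * e * k * p < n →
        Walk (Above b A) (q , n + e * p) (q′ , b) → Walk A (q , n) (q′ , b)
      reroute-down {n = n} far w
        with n′ , eq , w′ ← proj₂ (descent per ∣e t≤b (≤-trans (<⇒≤ far) (m≤m+n n _)) w)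
        with refl ← +-cancelʳ-≡ (e * p) n n′ eq = w′

    module _ {B} (perB : Periodic t (e * p) B) where

      until-periodic : Periodic (b + k * e * k * p) (e * p) (FinitePath A B)
      until-periodic q n far = mk⇔ forth back
        where
        forth : FinitePath A B (q , n) → FinitePath A B (q , n + e * p)
        forth path with _ , w , b∈ ← finite⇒walk {B = B} path with first-hit (b< far) w
        ... | inj₁ (w′ , b<) =
          walk⇒finite {B = B} (relax proj₂ (shift-up multiple t≤b w′)) (to (perB _ _ (≤-<-trans t≤b b<)) b∈)
        ... | inj₂ (_ , w₁ , w₂) = walk⇒finite {B = B} (reroute-up far w₁ ◅◅ w₂) b∈
        back : FinitePath A B (q , n + e * p) → FinitePath A B (q , n)
        back path with _ , w , b∈ ← finite⇒walk {B = B} path with first-hit (≤-trans (b< far) (m≤m+n n (e * p))) w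
        ... | inj₂ (_ , w₁ , w₂) = walk⇒finite {B = B} (reroute-down far w₁ ◅◅ w₂) b∈
        ... | inj₁ (w′ , b<) with n′ , refl , w″ ← shift-down multiple ≤-refl w′ =
          walk⇒finite {B = B} (relax proj₂ w″) (from (perB _ _ (+-cancelʳ-< (e * p) t n′ b<)) b∈)

      weak-until-periodic : Periodic (b + k * e * k * p) (e * p) (λ s → FinitePath A B s ⊎ InfinitePath A s)
      weak-until-periodic q n far = mk⇔
        [ inj₁ ∘ to (until-periodic q n far) , inj₂ ∘ forth ]′
        [ inj₁ ∘ from (until-periodic q n far) , inj₂ ∘ back ]′
        where
        forth : InfinitePath A (q , n) → InfinitePath A (q , n + e * p)
        forth path with infinite-hit per t≤b (b< far) path
        ... | inj₁ path′ = shift-infinite-up multiple t≤b path′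
        ... | inj₂ (_ , w , path′) = prepend (reroute-up far w) path′
        back : InfinitePath A (q , n + e * p) → InfinitePath A (q , n)
        back path with infinite-hit per t≤b (≤-trans (b< far) (m≤m+n n (e * p))) path
        ... | inj₁ path′ = shift-infinite-down multiple path′
        ... | inj₂ (_ , w , path′) = prepend (reroute-down far w) path′

  next-periodic : ∀ {t p A} → Periodic t p A → Periodic (suc t) p (λ s → ∃[ s′ ] (s ⟶ s′) × A s′)
  next-periodic {p = p} {A} per q n t<n = mk⇔
    (λ ((q′ , n′) , s⟶ , a) → (q′ , n′ + p) , translate p (≤-<-trans z≤n t<n) s⟶ ,
      to (per q′ n′ (s≤s⁻¹ (≤-trans t<n (⟶-level s⟶)))) a)
    back
    where
    back : (∃[ s′ ] ((q , n + p) ⟶ s′) × A s′) → ∃[ s′ ] ((q , n) ⟶ s′) × A s′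
    back (_ , s⟶ , a) with n′ , refl , s⟶′ ← untranslate p (≤-<-trans z≤n t<n) s⟶ =
      _ , s⟶′ , from (per _ n′ (s≤s⁻¹ (≤-trans t<n (⟶-level s⟶′)))) a

-- Periodicity of the semantics

∈⇒∣LCM : ∀ {n ns} → n ∈ ns → n ∣ LCM ns
∈⇒∣LCM {ns = n ∷ ns} (here refl)  = m∣lcm[m,n] n (LCM ns)
∈⇒∣LCM {ns = m ∷ ns} (there n∈ns) = ∣-trans (∈⇒∣LCM n∈ns) (n∣lcm[m,n] m (LCM ns))

lcm-pos : ∀ m n .{{_ : NonZero m}} .{{_ : NonZero n}} → NonZero (lcm m n)
lcm-pos m n = ≢-nonZero λ eq → m*n≢0′ (0∣⇒≡0 (subst (_∣ m * n) eq (lcm-least {m} {n} (m∣m*n n) (n∣m*n m))))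
  where
  m*n≢0′ : m * n ≢ 0
  m*n≢0′ = ≢-nonZero⁻¹ (m * n) {{m*n≢0 m n}}

lcmUpTo : ℕ → ℕ
lcmUpTo k = LCM (map suc (upTo k))

∣lcmUpTo : ∀ {k} j → suc j ≤ k → suc j ∣ lcmUpTo k
∣lcmUpTo j j<k = ∈⇒∣LCM (∈-map⁺ suc (∈-upTo⁺ j<k))

LCM-nonZero : ∀ ns → NonZero (LCM (map suc ns))
LCM-nonZero []       = _
LCM-nonZero (n ∷ ns) = lcm-pos (suc n) _ {{_}} {{LCM-nonZero ns}}

-- The range 1, ..., k grows at its end, whereas `LCM` recurs on the front of a list; this step lets
-- the least common multiple be built up factor by factor.
LCM-∷ʳ : ∀ ns n → LCM (ns ++ n ∷ []) ≡ lcm (LCM ns) n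
LCM-∷ʳ []       n = ∣-antisym (lcm-least (n∣lcm[m,n] 1 n) (1∣ _)) (lcm-least (1∣ _) (m∣lcm[m,n] n 1))
LCM-∷ʳ (m ∷ ns) n = trans (cong (lcm m) (LCM-∷ʳ ns n)) (∣-antisym
  (lcm-least (∣-trans (m∣lcm[m,n] m (LCM ns)) (m∣lcm[m,n] (LCM (m ∷ ns)) n))
    (lcm-least (∣-trans (n∣lcm[m,n] m (LCM ns)) (m∣lcm[m,n] (LCM (m ∷ ns)) n)) (n∣lcm[m,n] (LCM (m ∷ ns)) n)))
  (lcm-least (lcm-least (m∣lcm[m,n] m _) (∣-trans (m∣lcm[m,n] _ n) (n∣lcm[m,n] m _)))
    (∣-trans (n∣lcm[m,n] (LCM ns) n) (n∣lcm[m,n] m _))))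

lcmUpTo-suc : ∀ k → lcmUpTo (suc k) ≡ lcm (lcmUpTo k) (suc k)
lcmUpTo-suc k = trans (cong (LCM ∘ map suc) (sym (upTo-∷ʳ k)))
  (trans (cong LCM (map-++ suc (upTo k) (k ∷ []))) (LCM-∷ʳ (map suc (upTo k)) (suc k)))

threshold : ∀ {P} → OCP P → CTL P → ℕ
threshold 𝒪 φ = 2 * size φ * OCP.k 𝒪 ^ 2 * period 𝒪 φ

module _ {P : Set} (𝒪 : OCP P) .{{k≢0 : NonZero (OCP.k 𝒪)}} where
  open OCP 𝒪
  open Semantics (T 𝒪)

  private
    K : ℕ
    K = lcmUpTo k

    instance
      K≢0 : NonZero K
      K≢0 = LCM-nonZero (upTo k)

    K^≢0 : ∀ l → NonZero (K ^ l)
    K^≢0 l = m^n≢0 K l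

    θ : ℕ → ℕ → ℕ
    θ s l = 2 * s * k ^ 2 * K ^ l

    θ-mono : ∀ {s s′ l l′} → s ≤ s′ → l ≤ l′ → θ s l ≤ θ s′ l′
    θ-mono s≤s′ l≤l′ = *-mono-≤ (*-monoˡ-≤ (k ^ 2) (*-monoʳ-≤ 2 s≤s′)) (^-monoʳ-≤ K l≤l′)

    K^-split : ∀ {l l′} → l ≤ l′ → K ^ (l′ ∸ l) * K ^ l ≡ K ^ l′
    K^-split {l} {l′} l≤l′ = trans (sym (^-distribˡ-+-* K (l′ ∸ l) l)) (cong (K ^_) (m∸n+n≡m l≤l′))

    upgrade : ∀ {s s′ l l′} A → s ≤ s′ → l ≤ l′ →
              Periodic 𝒪 (θ s l) (K ^ l) A → Periodic 𝒪 (θ s′ l′) (K ^ l′) A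
    upgrade {s} {s′} {l} {l′} A s≤s′ l≤l′ per =
      subst (λ p → Periodic 𝒪 (θ s′ l′) p A) (K^-split l≤l′)
        (periodic-* 𝒪 {A = A} (K ^ (l′ ∸ l)) (periodic-raise 𝒪 {A = A} (θ-mono s≤s′ l≤l′) per))

    -- The origin of the factor 2 in the bound: of the two summands, one covers the margin `e * p`
    -- above the old threshold and the other the height `k * e * k * p` consumed by shortening.
    θ-suc : ∀ s l → θ (s + 1) l ≡ θ s l + (k * k * K ^ l + k * k * K ^ l)
    θ-suc s l = expand s k (K ^ l)
      where
      expand : ∀ s k x → 2 * (s + 1) * (k * (k * 1)) * x ≡ 2 * s * (k * (k * 1)) * x + (k * k * x + k * k * x)
      expand = solve-∀

    ≤kkK : ∀ l → K ^ l ≤ k * k * K ^ l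
    ≤kkK l = m≤n*m (K ^ l) (k * k) {{m*n≢0 k k}}

    suc-θ : ∀ s l → suc (θ s l) ≤ θ (s + 1) l
    suc-θ s l = ≤-trans (m<m+n (θ s l) (≤-trans (>-nonZero⁻¹ (K ^ l) {{K^≢0 l}})
      (≤-trans (≤kkK l) (m≤m+n _ _)))) (≤-reflexive (sym (θ-suc s l)))

    -- e p is the period of the until formula, with p the period of φ.
    module Until (φ ψ : CTL P) where
      L = (lud φ + 1) ⊔ lud ψ
      s = size φ + size ψ
      l<L : suc (lud φ) ≤ L
      l<L = ≤-trans (≤-reflexive (+-comm 1 (lud φ))) (m≤m⊔n (lud φ + 1) (lud ψ))
      l≤L = ≤-trans (n≤1+n _) l<L
      p = K ^ lud φ
      e = K ^ (L ∸ lud φ)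
      instance
        p≢0 : NonZero p
        p≢0 = K^≢0 (lud φ)
        e≢0 : NonZero e
        e≢0 = K^≢0 (L ∸ lud φ)
      -- As `L` exceeds `lud φ`, the exponent in `e` is positive and `K` divides `e`.
      ∣e : ∀ j → suc j ≤ k → suc j ∣ e
      ∣e j j<k = ∣-trans (∣lcmUpTo j j<k) (∣-trans (m∣m*n (K ^ (L ∸ suc (lud φ))))
        (∣-reflexive (cong (K ^_) (sym (+-∸-assoc 1 l<L)))))
      t≤ : θ s L + e * p + k * e * k * p ≤ θ (s + 1) L
      t≤ = ≤-trans (≤-reflexive (trans (regroup (θ s L) k e p) (cong (λ x → θ s L + (x + k * k * x)) (K^-split l≤L))))
             (≤-trans (+-monoʳ-≤ (θ s L) (+-monoˡ-≤ (k * k * K ^ L) (≤kkK L))) (≤-reflexive (sym (θ-suc s L))))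
        where
        regroup : ∀ t k e p → t + e * p + k * e * k * p ≡ t + (e * p + k * k * (e * p))
        regroup = solve-∀
      perφ : Periodic 𝒪 (θ (size φ) (lud φ)) p ⟦ φ ⟧ → Periodic 𝒪 (θ s L) p ⟦ φ ⟧
      perφ = periodic-raise 𝒪 {A = ⟦ φ ⟧} (θ-mono (m≤m+n (size φ) (size ψ)) l≤L)
      perψ : Periodic 𝒪 (θ (size ψ) (lud ψ)) (K ^ lud ψ) ⟦ ψ ⟧ → Periodic 𝒪 (θ s L) (e * p) ⟦ ψ ⟧
      perψ per = subst (λ p → Periodic 𝒪 (θ s L) p ⟦ ψ ⟧) (sym (K^-split l≤L))
        (upgrade ⟦ ψ ⟧ (m≤n+m (size ψ) (size φ)) (m≤n⊔m (lud φ + 1) (lud ψ)) per)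
      conclude : ∀ A → Periodic 𝒪 (θ s L + e * p + k * e * k * p) (e * p) A → Periodic 𝒪 (θ (s + 1) L) (K ^ L) A
      conclude A per = subst (λ p → Periodic 𝒪 (θ (s + 1) L) p A) (K^-split l≤L) (periodic-raise 𝒪 {A = A} t≤ per)

  periodic : ∀ φ → Periodic 𝒪 (threshold 𝒪 φ) (period 𝒪 φ) ⟦ φ ⟧
  periodic (atom p) q n _ = mk⇔ id id
  periodic (¬′ φ) q n t<n = mk⇔ (_∘ from φ⇔) (_∘ to φ⇔)
    where φ⇔ = upgrade {l = lud φ} ⟦ φ ⟧ (m≤m+n (size φ) 1) ≤-refl (periodic φ) q n t<n
  periodic (φ ∧′ ψ) q n t<n = mk⇔ (Product.map (to φ⇔) (to ψ⇔)) (Product.map (from φ⇔) (from ψ⇔))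
    where
    φ⇔ = upgrade ⟦ φ ⟧ (≤-trans (m≤m+n (size φ) (size ψ)) (m≤m+n _ 1)) (m≤m⊔n (lud φ) (lud ψ)) (periodic φ) q n t<n
    ψ⇔ = upgrade ⟦ ψ ⟧ (≤-trans (m≤n+m (size ψ) (size φ)) (m≤m+n _ 1)) (m≤n⊔m (lud φ) (lud ψ)) (periodic ψ) q n t<n
  periodic (EX φ) = periodic-raise 𝒪 {A = ⟦ EX φ ⟧} (suc-θ (size φ) (lud φ))
    (next-periodic 𝒪 {A = ⟦ φ ⟧} (periodic φ))
  periodic (E φ U ψ) = conclude _ (until-periodic 𝒪 (perφ (periodic φ)) ∣e (perψ (periodic ψ)))
    where open Until φ ψ
  periodic (E φ WU ψ) = conclude _ (weak-until-periodic 𝒪 (perφ (periodic φ)) ∣e (perψ (periodic ψ)))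
    where open Until φ ψ

  periodic⇒invariant : ∀ {t p A} → Periodic 𝒪 t p A → ∀ {n n′} → n > t → n′ > t → n ≡ n′ [mod p ] →
                       ∀ q → A (q , n) ⇔ A (q , n′)
  periodic⇒invariant {t} {p} {A} per {n} {n′} n>t n′>t p∣ q = [
    (λ n≤n′ → ordered n>t n≤n′ p∣) ,
    (λ n′≤n → ⇔.sym (ordered n′>t n′≤n (subst (p ∣_) (∣-∣-comm n n′) p∣))) ]′ (≤-total n n′)
    where
    ordered : ∀ {n n′} → n > t → n ≤ n′ → n ≡ n′ [mod p ] → A (q , n) ⇔ A (q , n′)
    ordered {n} {n′} n>t n≤n′ (divides c eq) =
      subst (λ m → A (q , n) ⇔ A (q , m))
        (trans (cong (λ d → n + d) (trans (sym eq) (m≤n⇒∣m-n∣≡n∸m n≤n′))) (m+[n∸m]≡n n≤n′))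
        (periodic-* 𝒪 {A = A} c per q n n>t)

-- Programs with a bounded number of rounds

-- A branch is a function of the stack top; an explicit list of all tops allows a maximum over its
-- continuations.
tops : List (Maybe Symbol)
tops = nothing ∷ map just (bit 0b ∷ bit 1b ∷ # ∷ $ ∷ at ∷ not ∷ and ∷ ex ∷ eu ∷ ew ∷ [])

∈tops : ∀ x → x ∈ tops
∈tops nothing                 = here refl
∈tops (just (bit zero))       = there (here refl)
∈tops (just (bit (suc zero))) = there (there (here refl))
∈tops (just #)                = there (there (there (here refl)))
∈tops (just $)                = there (there (there (there (here refl))))
∈tops (just at)               = there (there (there (there (there (here refl)))))
∈tops (just not)              = there (there (there (there (there (there (here refl))))))
∈tops (just and)              = there (there (there (there (there (there (there (here refl)))))))
∈tops (just ex)               = there (there (there (there (there (there (there (there (here refl))))))))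
∈tops (just eu)               = there (there (there (there (there (there (there (there (there (here refl)))))))))
∈tops (just ew)               = there (there (there (there (there (there (there (there (there (there (here refl))))))))))

greatest : {A : Set} → (A → ℕ) → List A → ℕ
greatest f = foldr (λ x → f x ⊔_) 0

≤greatest : ∀ {A : Set} (f : A → ℕ) {x xs} → x ∈ xs → f x ≤ greatest f xs
≤greatest f {xs = x ∷ xs} (here refl) = m≤m⊔n (f x) _
≤greatest f {xs = y ∷ xs} (there x∈)  = ≤-trans (≤greatest f x∈) (m≤n⊔m (f y) _)

-- If every loop of a run is left after at most S rounds,
-- then the run takes at most S ^ degree steps.
degree : ∀ {r} → Program r → ℕ
degree skip          = 0
degree (push i a)    = 0
degree (pop i)       = 0
degree (c ⨾ d)       = suc (degree c ⊔ degree d)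
degree (branch i f)  = suc (greatest (λ x → degree (f x)) tops)
degree (while i b c) = 2 + degree c

module Running (S : ℕ) (3≤S : 3 ≤ S) {r : ℕ} where

  private
    instance
      S≢0 : NonZero S
      S≢0 = >-nonZero (≤-trans (s≤s z≤n) 3≤S)

    1≤S^ : ∀ d → 1 ≤ S ^ d
    1≤S^ d = >-nonZero⁻¹ (S ^ d) {{m^n≢0 S d}}

    double≤ : ∀ d → S ^ d + S ^ d ≤ S ^ suc d
    double≤ d = ≤-trans (≤-reflexive (cong (S ^ d +_) (sym (+-identityʳ (S ^ d)))))
                        (*-monoˡ-≤ (S ^ d) (≤-trans (n≤1+n 2) 3≤S))

  -- The bound depends on the program alone, so exact step counts never have to be followed: an
  -- analysis only has to show that each loop makes at most `S` rounds.
  record Runs (c : Program r) (σ τ : Stacks r) : Set where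
    constructor runs
    field
      steps  : ℕ
      run    : ⟨ c , σ ⟩⇓[ steps ] τ
      bound  : steps ≤ S ^ degree c

  skipᵣ : ∀ {σ} → Runs skip σ σ
  skipᵣ = runs 1 skip ≤-refl

  pushᵣ : ∀ {i a σ} → Runs (push i a) σ (σ [ i ]%= (a ∷_))
  pushᵣ = runs 1 push ≤-refl

  popᵣ : ∀ {i σ} → Runs (pop i) σ (σ [ i ]%= drop 1)
  popᵣ = runs 1 pop ≤-refl

  infixr 5 _⨾ᵣ_
  _⨾ᵣ_ : ∀ {c d σ τ υ} → Runs c σ τ → Runs d τ υ → Runs (c ⨾ d) σ υ
  _⨾ᵣ_ {c} {d} (runs m u m≤) (runs n v n≤) = runs (m + n) (u ⨾ v) (≤-trans
    (+-mono-≤ (≤-trans m≤ (^-monoʳ-≤ S (m≤m⊔n (degree c) (degree d))))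
              (≤-trans n≤ (^-monoʳ-≤ S (m≤n⊔m (degree c) (degree d)))))
    (double≤ (degree c ⊔ degree d)))

  branchᵣ : ∀ {i f σ τ} → Runs (f (top i σ)) σ τ → Runs (branch i f) σ τ
  branchᵣ {i} {f} {σ} (runs n u n≤) = runs (suc n) (branch u) (≤-trans
    (+-mono-≤ (1≤S^ d) (≤-trans n≤ (^-monoʳ-≤ S (≤greatest (λ x → degree (f x)) (∈tops (top i σ))))))
    (double≤ d))
    where d = greatest (λ x → degree (f x)) tops

  data Rounds (i : Fin r) (b : Maybe Symbol → Bool) (c : Program r) : ℕ → Stacks r → Stacks r → Set where
    []  : ∀ {σ} → Rounds i b c 0 σ σ
    _∷_ : ∀ {m σ τ υ} → b (top i σ) ≡ true × Runs c σ τ → Rounds i b c m τ υ → Rounds i b c (suc m) σ υ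

  infixr 5 _++ᵣ_
  _++ᵣ_ : ∀ {i b c m n σ τ υ} → Rounds i b c m σ τ → Rounds i b c n τ υ → Rounds i b c (m + n) σ υ
  []      ++ᵣ v = v
  (x ∷ u) ++ᵣ v = x ∷ (u ++ᵣ v)

  whileᵣ : ∀ {i b c m σ τ} → Rounds i b c m σ τ → b (top i τ) ≡ false → m ≤ S → Runs (while i b c) σ τ
  whileᵣ {i} {b} {c} {m} {σ} {τ} us exit m≤S = runs _ (proj₁ (proj₂ (unroll us)))
    (≤-trans (proj₂ (proj₂ (unroll us))) (≤-trans (s≤s (*-monoˡ-≤ (suc x) m≤S)) bound))
    where
    x = S ^ degree c
    unroll : ∀ {m σ} → Rounds i b c m σ τ → ∃[ n ] ⟨ while i b c , σ ⟩⇓[ n ] τ × n ≤ suc (m * suc x)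
    unroll [] = 1 , while-false exit , ≤-refl
    unroll ((enter , runs l u l≤) ∷ us) with n , v , n≤ ← unroll us =
      suc (l + n) , while-true enter u v ,
      s≤s (≤-trans (+-mono-≤ l≤ n≤) (≤-reflexive (+-suc x _)))
    triple : ∀ y → y + (y + y) ≡ 3 * y
    triple = solve-∀
    -- One exit test and `S` rounds of `suc x` steps amount to at most `3 * (S * x)`; the assumption
    -- `3 ≤ S` absorbs the 3 into a second power of `S`.
    bound : suc (S * suc x) ≤ S ^ (2 + degree c)
    bound = ≤-trans (+-mono-≤ (≤-trans (1≤S^ (degree c)) (m≤n*m x S)) (≤-reflexive (*-suc S x)))
      (≤-trans (+-monoʳ-≤ (S * x) (+-monoˡ-≤ (S * x) (m≤m*n S x {{m^n≢0 S (degree c)}})))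
      (≤-trans (≤-reflexive (triple (S * x))) (*-monoˡ-≤ (S * x) 3≤S)))

-- Moving, clearing and copying stack contents

infixr 5 _▸_
_▸_ : ∀ {r} → Program r → Program r → Program r
c ▸ d = c ⨾ d

one : Symbol
one = bit 1b

ones : ℕ → List Symbol
ones n = replicate n one

isOne isBit not$ nonEmpty : Maybe Symbol → Bool
isOne (just (bit (suc zero))) = true
isOne _                       = false
isBit (just (bit _)) = true
isBit _              = false
not$ (just $) = false
not$ _        = true
nonEmpty (just _) = true
nonEmpty nothing  = false

ifOne : ∀ {r} → Fin r → Program r → Program r → Program r
ifOne i c d = branch i (λ x → if isOne x then c else d)

transfer : ∀ {r} → Fin r → Fin r → Maybe Symbol → Program r
transfer i j (just a) = pop i ▸ push j a
transfer i j nothing  = skip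

module _ {r : ℕ} where

  move : (Maybe Symbol → Bool) → Fin r → Fin r → Program r
  move b i j = while i b (branch i (transfer i j))

  clear : Fin r → Program r
  clear i = while i isOne (pop i)

  -- Reading a unary number destroys it, so a copy passes through the auxiliary stack `t`, from
  -- which `i` and `j` are both refilled.
  spread copy : Fin r → Fin r → Fin r → Program r
  spread t i j = while t isOne (pop t ▸ push i one ▸ push j one)
  copy i j t = move isOne i t ▸ spread t i j

module _ {A : Set} {r : ℕ} {i j : Fin r} (i≢j : i ≢ j) where

  updateAt₂-∘ : ∀ {f f′ g g′ : A → A} (σ : Vec A r) →
    σ [ i ]%= f′ [ j ]%= g′ [ i ]%= f [ j ]%= g ≡ σ [ i ]%= (f ∘ f′) [ j ]%= (g ∘ g′)
  updateAt₂-∘ {f} {f′} {g} {g′} σ =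
    trans (cong (_[ j ]%= g) (Vec.updateAt-commutes i j i≢j (σ [ i ]%= f′)))
      (trans (Vec.updateAt-updateAt j (σ [ i ]%= f′ [ i ]%= f))
        (cong (_[ j ]%= (g ∘ g′)) (Vec.updateAt-updateAt i σ)))

onesʳ++ : ∀ n y → ones n ʳ++ y ≡ ones n ++ y
onesʳ++ zero    y = refl
onesʳ++ (suc n) y = trans (onesʳ++ n (one ∷ y)) (shift n)
  where
  shift : ∀ n → ones n ++ one ∷ y ≡ one ∷ ones n ++ y
  shift zero    = refl
  shift (suc n) = cong (one ∷_) (shift n)

head-++ : ∀ {A : Set} {x : A} {xs ys} → xs ≡ x ∷ ys → head xs ≡ just x
head-++ refl = refl

module Macros (S : ℕ) (3≤S : 3 ≤ S) {r : ℕ} where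
  open Running S 3≤S {r}

  -- The final state is expressed by updates of an arbitrary stack vector. At concrete registers
  -- these compute, so that runs of macros compose by definitional equality.
  moveᵣ : ∀ {b i j} {i≢j : False (i Fin.≟ j)} {σ} w {v} → All (λ a → b (just a) ≡ true) w → b (head v) ≡ false →
          Vec.lookup σ i ≡ w ++ v → length w ≤ S →
          Runs (move b i j) σ (σ [ i ]%= const v [ j ]%= (w ʳ++_))
  moveᵣ {b} {i} {j} {i≢j} {σ} w {v} bs exit eq len =
    whileᵣ (rounds w bs σ eq) (trans (cong (b ∘ head) (top-after σ w)) exit) len
    where
    ij = toWitnessFalse i≢j
    top-after : ∀ σ w → Vec.lookup (σ [ i ]%= const v [ j ]%= (w ʳ++_)) i ≡ v
    top-after σ w = trans (Vec.lookup∘updateAt′ i j ij (σ [ i ]%= const v)) (Vec.lookup∘updateAt i σ)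
    body : ∀ {a u σ} → Vec.lookup σ i ≡ a ∷ u → Runs (branch i (transfer i j)) σ (σ [ i ]%= drop 1 [ j ]%= (a ∷_))
    body {a} {σ = σ} eq = branchᵣ
      (subst (λ x → Runs (transfer i j x) σ (σ [ i ]%= drop 1 [ j ]%= (a ∷_))) (sym (head-++ eq)) (popᵣ ⨾ᵣ pushᵣ))
    rounds : ∀ w → All (λ a → b (just a) ≡ true) w → ∀ σ → Vec.lookup σ i ≡ w ++ v →
             Rounds i b (branch i (transfer i j)) (length w) σ (σ [ i ]%= const v [ j ]%= (w ʳ++_))
    rounds [] [] σ eq = subst (Rounds i b _ 0 σ) (sym (trans
      (Vec.updateAt-id j (σ [ i ]%= const v)) (Vec.updateAt-id-local i σ (sym eq)))) []
    rounds (a ∷ w) (ba ∷ bs) σ eq =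
      (trans (cong b (head-++ eq)) ba , body eq) ∷
      subst (Rounds i b _ _ σ′) (updateAt₂-∘ ij σ) (rounds w bs σ′
        (trans (Vec.lookup∘updateAt′ i j ij (σ [ i ]%= drop 1)) (trans (Vec.lookup∘updateAt i σ) (cong (drop 1) eq))))
      where σ′ = σ [ i ]%= drop 1 [ j ]%= (a ∷_)

  allOnes : ∀ n → All (λ a → isOne (just a) ≡ true) (ones n)
  allOnes zero    = []
  allOnes (suc n) = refl ∷ allOnes n

  length-ones : ∀ n → length (ones n) ≡ n
  length-ones zero    = refl
  length-ones (suc n) = cong suc (length-ones n)

  moveOnesᵣ : ∀ {i j} {i≢j : False (i Fin.≟ j)} {σ} n {v} → isOne (head v) ≡ false →
              Vec.lookup σ i ≡ ones n ++ v → n ≤ S →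
              Runs (move isOne i j) σ (σ [ i ]%= const v [ j ]%= (ones n ++_))
  moveOnesᵣ {i} {j} {i≢j} {σ} n {v} exit eq n≤S =
    subst (Runs (move isOne i j) σ) (Vec.updateAt-cong j (onesʳ++ n) (σ [ i ]%= const v))
      (moveᵣ {i≢j = i≢j} (ones n) (allOnes n) exit eq (subst (_≤ S) (sym (length-ones n)) n≤S))

  clearᵣ : ∀ {i σ} n {v} → isOne (head v) ≡ false → Vec.lookup σ i ≡ ones n ++ v → n ≤ S →
           Runs (clear i) σ (σ [ i ]%= const v)
  clearᵣ {i} {σ} n {v} exit eq n≤S =
    whileᵣ (rounds n σ eq) (trans (cong (isOne ∘ head) (Vec.lookup∘updateAt i σ)) exit) n≤S
    where
    rounds : ∀ n σ → Vec.lookup σ i ≡ ones n ++ v → Rounds i isOne (pop i) n σ (σ [ i ]%= const v)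
    rounds zero    σ eq = subst (Rounds i isOne (pop i) 0 σ) (sym (Vec.updateAt-id-local i σ (sym eq))) []
    rounds (suc n) σ eq = (cong isOne (head-++ eq) , popᵣ) ∷
      subst (Rounds i isOne (pop i) n _) (Vec.updateAt-updateAt i σ)
        (rounds n (σ [ i ]%= drop 1) (trans (Vec.lookup∘updateAt i σ) (cong (drop 1) eq)))

  spreadᵣ : ∀ {t i j} {t≢i : False (t Fin.≟ i)} {t≢j : False (t Fin.≟ j)} {i≢j : False (i Fin.≟ j)} {σ} n {v} →
            isOne (head v) ≡ false → Vec.lookup σ t ≡ ones n ++ v → n ≤ S →
            Runs (spread t i j) σ (σ [ t ]%= const v [ i ]%= (ones n ++_) [ j ]%= (ones n ++_))
  spreadᵣ {t} {i} {j} {t≢i} {t≢j} {i≢j} {σ} n {v} exit eq n≤S =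
    whileᵣ (rounds n σ eq) (trans (cong (isOne ∘ head) top-after) exit) n≤S
    where
    ti = toWitnessFalse t≢i
    tj = toWitnessFalse t≢j
    ij = toWitnessFalse i≢j
    lookup-t : ∀ {f g h} σ → Vec.lookup (σ [ t ]%= f [ i ]%= g [ j ]%= h) t ≡ f (Vec.lookup σ t)
    lookup-t {f} {g} {h} σ = trans (Vec.lookup∘updateAt′ t j tj (σ [ t ]%= f [ i ]%= g))
      (trans (Vec.lookup∘updateAt′ t i ti (σ [ t ]%= f)) (Vec.lookup∘updateAt t σ))
    top-after : Vec.lookup (σ [ t ]%= const v [ i ]%= (ones n ++_) [ j ]%= (ones n ++_)) t ≡ v
    top-after = lookup-t σ
    ones-suc : ∀ n y → ones n ++ one ∷ y ≡ one ∷ ones n ++ y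
    ones-suc zero    y = refl
    ones-suc (suc n) y = cong (one ∷_) (ones-suc n y)
    merge : ∀ {f f′ g g′ h h′} (σ : Stacks r) →
            σ [ t ]%= f′ [ i ]%= g′ [ j ]%= h′ [ t ]%= f [ i ]%= g [ j ]%= h ≡
            σ [ t ]%= (f ∘ f′) [ i ]%= (g ∘ g′) [ j ]%= (h ∘ h′)
    merge {f} {f′} {g} {g′} {h} {h′} σ =
      trans (cong (λ υ → υ [ i ]%= g [ j ]%= h) (Vec.updateAt-commutes t j tj (σ [ t ]%= f′ [ i ]%= g′)))
      (trans (cong (_[ j ]%= h) (Vec.updateAt-commutes i j ij (σ [ t ]%= f′ [ i ]%= g′ [ t ]%= f)))
      (trans (Vec.updateAt-updateAt j (σ [ t ]%= f′ [ i ]%= g′ [ t ]%= f [ i ]%= g))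
      (cong (_[ j ]%= (h ∘ h′)) (updateAt₂-∘ ti σ))))
    body = pop t ▸ push i one ▸ push j one
    rounds : ∀ n σ → Vec.lookup σ t ≡ ones n ++ v →
             Rounds t isOne body n σ (σ [ t ]%= const v [ i ]%= (ones n ++_) [ j ]%= (ones n ++_))
    rounds zero    σ eq = subst (Rounds t isOne body 0 σ) (sym (trans (Vec.updateAt-id j _)
      (trans (Vec.updateAt-id i _) (Vec.updateAt-id-local t σ (sym eq))))) []
    rounds (suc n) σ eq = (cong isOne (head-++ eq) , popᵣ ⨾ᵣ pushᵣ ⨾ᵣ pushᵣ) ∷
      subst (Rounds t isOne body n _)
        (trans (merge σ) (trans (Vec.updateAt-cong j (ones-suc n) _)
          (cong (_[ j ]%= _) (Vec.updateAt-cong i (ones-suc n) _))))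
        (rounds n _ (trans (lookup-t σ) (cong (drop 1) eq)))

  copyᵣ : ∀ {i j t} {t≢i : False (t Fin.≟ i)} {t≢j : False (t Fin.≟ j)} {i≢j : False (i Fin.≟ j)}
          {i≢t : False (i Fin.≟ t)} {σ} n {v u} → isOne (head v) ≡ false → isOne (head u) ≡ false →
          Vec.lookup σ i ≡ ones n ++ v → Vec.lookup σ t ≡ u → n ≤ S →
          Runs (copy i j t) σ
            (σ [ i ]%= const v [ t ]%= (ones n ++_) [ t ]%= const u [ i ]%= (ones n ++_) [ j ]%= (ones n ++_))
  copyᵣ {i} {j} {t} {t≢i} {t≢j} {i≢j} {i≢t} {σ} n {v} {u} exit exit′ eq eq′ n≤S =
    moveOnesᵣ {i≢j = i≢t} n exit eq n≤S ⨾ᵣ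
    spreadᵣ {t≢i = t≢i} {t≢j = t≢j} {i≢j = i≢j} n exit′
      (trans (Vec.lookup∘updateAt t (σ [ i ]%= const v))
        (cong (ones n ++_) (trans (Vec.lookup∘updateAt′ t i (toWitnessFalse t≢i) σ) eq′))) n≤S

-- Multiplication of a binary number by a unary one

-- The registers from loc on are held in unary.
record Store : Set where
  field
    inp pend out fac fac′                             : List Symbol
    loc siz dep tmp tmp′ car flag mul cnt lo hi res   : ℕ

open Store

pattern INP  = zero
pattern PEND = suc zero
pattern OUT  = suc (suc zero)
pattern FAC  = suc (suc (suc zero))
pattern FAC′ = suc FAC
pattern LOC  = suc FAC′
pattern SIZ  = suc LOC
pattern DEP  = suc SIZ
pattern TMP  = suc DEP
pattern TMP′ = suc TMP
pattern CAR  = suc TMP′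
pattern FLAG = suc CAR
pattern MUL  = suc FLAG
pattern CNT  = suc MUL
pattern LO   = suc CNT
pattern HI   = suc LO
pattern RES  = suc HI

-- The trailing `[]` gives every unary register the shape `ones n ++ v` that the macros expect.
unary : ℕ → List Symbol
unary n = ones n ++ []

⟪_⟫ : Store → Stacks 17
⟪ s ⟫ = inp s ∷ pend s ∷ out s ∷ fac s ∷ fac′ s ∷ unary (loc s) ∷ unary (siz s) ∷ unary (dep s) ∷
        unary (tmp s) ∷ unary (tmp′ s) ∷ unary (car s) ∷ unary (flag s) ∷ unary (mul s) ∷
        unary (cnt s) ∷ unary (lo s) ∷ unary (hi s) ∷ unary (res s) ∷ []

ones-+ : ∀ m n v → ones m ++ ones n ++ v ≡ ones (m + n) ++ v
ones-+ zero    n v = refl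
ones-+ (suc m) n v = cong (one ∷_) (ones-+ m n v)

-- Each pair of ones on `CAR` becomes a single one on `TMP`; an unpaired one is remembered on `FLAG`
-- as the remainder of the halving.
pair : Program 17
pair = pop CAR ▸ ifOne CAR (pop CAR ▸ push TMP one) (push FLAG one)

halve : Program 17
halve = while CAR isOne pair ▸
        ifOne FLAG (pop FLAG ▸ push OUT one) (push OUT (bit 0b)) ▸
        move isOne TMP CAR

-- Schoolbook multiplication from the least significant bit, with the carry in unary: if the bit is
-- set, the multiplier joins the carry, whose parity is the next bit of the product and whose half
-- is the next carry.
digit : Program 17
digit = ifOne INP (copy MUL CAR TMP) skip ▸ pop INP ▸ halve

multiply : Program 17
multiply = while INP isBit digit ▸
           while CAR isOne halve ▸
           move isBit OUT INP

module Multiplication (S : ℕ) (3≤S : 3 ≤ S) where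
  open Running S 3≤S {17}
  open Macros S 3≤S {17}

  private
    module Halving (s : Store) where
      state : ℕ → ℕ → ℕ → Store
      state c t f = record s { car = c ; tmp = t ; flag = f }

      pairs : ∀ c t → ∃[ b ] ∃[ h ] c ≡ toℕ {2} b + h * 2 ×
              Rounds CAR isOne pair (h + toℕ b) ⟪ state c t 0 ⟫ ⟪ state 0 (h + t) (toℕ b) ⟫
      pairs 0 t = zero , 0 , refl , []
      pairs 1 t = suc zero , 0 , refl , (refl , popᵣ ⨾ᵣ branchᵣ pushᵣ) ∷ []
      pairs (suc (suc c)) t with b , h , c≡ , rounds ← pairs c (suc t) =
        b , suc h , trans (cong (2 +_) c≡) (rearrange (toℕ b) h) ,
        (refl , popᵣ ⨾ᵣ branchᵣ (popᵣ ⨾ᵣ pushᵣ)) ∷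
        subst (λ t′ → Rounds CAR isOne pair (h + toℕ b) ⟪ state c (suc t) 0 ⟫ ⟪ state 0 t′ (toℕ b) ⟫)
          (+-suc h t) rounds
        where
        rearrange : ∀ b h → 2 + (b + h * 2) ≡ b + (2 + h * 2)
        rearrange = solve-∀

      emit : ∀ b h → Runs (ifOne FLAG (pop FLAG ▸ push OUT one) (push OUT (bit 0b)))
                       ⟪ state 0 h (toℕ {2} b) ⟫ ⟪ record (state 0 h 0) { out = bit b ∷ out s } ⟫
      emit zero       h = branchᵣ pushᵣ
      emit (suc zero) h = branchᵣ (popᵣ ⨾ᵣ pushᵣ)

      half≤ : ∀ b h → h + toℕ {2} b ≤ toℕ b + h * 2
      half≤ b h = ≤-trans (+-monoˡ-≤ (toℕ b) (m≤m*n h 2)) (≤-reflexive (+-comm (h * 2) (toℕ b)))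

  halveᵣ : ∀ s c → c ≤ S → ∃[ b ] ∃[ h ] c ≡ toℕ {2} b + h * 2 ×
           Runs halve ⟪ record s { car = c ; tmp = 0 ; flag = 0 } ⟫
                      ⟪ record s { car = h ; tmp = 0 ; flag = 0 ; out = bit b ∷ out s } ⟫
  halveᵣ s c c≤S with b , h , refl , rounds ← Halving.pairs s c 0 = b , h , refl ,
    whileᵣ rounds refl bound ⨾ᵣ
    Halving.emit s b (h + 0) ⨾ᵣ
    moveOnesᵣ h refl (cong unary (+-identityʳ h)) (≤-trans (m≤m+n h (toℕ b)) bound)
    where bound = ≤-trans (Halving.half≤ s b h) c≤S

  half< : ∀ b h {c} → suc c ≡ toℕ {2} b + h * 2 → h < suc c
  half< b          zero    eq = z<s
  half< zero       (suc h) eq = subst (suc h <_) (sym eq) (m<m*n (suc h) 2 (n<1+n 1))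
  half< (suc zero) (suc h) eq = subst (suc h <_) (sym eq) (m<n⇒m<1+n (m<m*n (suc h) 2 (n<1+n 1)))

  -- This keeps the carry bounded by the multiplier: adding the multiplier to such a carry gives at
  -- most twice the multiplier, and halving restores the bound.
  half-mono : ∀ b h {m} → toℕ {2} b + h * 2 ≤ m + m → h ≤ m
  half-mono b h {m} le = *-cancelʳ-≤ h m 2 (≤-trans (m≤n+m (h * 2) (toℕ b)) (≤-trans le (≤-reflexive (double m))))
    where
    double : ∀ m → m + m ≡ m * 2
    double = solve-∀

  -- Bounding the number of digits by the carry itself is crude but sufficient, because the carry
  -- never exceeds a multiplier that is held in unary.
  flushᵣ : ∀ s c → Acc _<_ c → c ≤ S → ∃[ ds ] fromDigits ds ≡ c × length ds ≤ c ×
           Rounds CAR isOne halve (length ds)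
             ⟪ record s { car = c ; tmp = 0 ; flag = 0 } ⟫
             ⟪ record s { car = 0 ; tmp = 0 ; flag = 0 ; out = map bit ds ʳ++ out s } ⟫
  flushᵣ s zero    _         c≤S = [] , refl , z≤n , []
  flushᵣ s (suc c) (acc rec) c≤S
    with b , h , c≡ , r ← halveᵣ s (suc c) c≤S
    with h<c ← half< b h c≡
    with ds , eq , len , rs ← flushᵣ (record s { out = bit b ∷ out s }) h (rec h<c) (≤-trans (<⇒≤ h<c) c≤S) =
    b ∷ ds , trans (cong (λ n → toℕ b + n * 2) eq) (sym c≡) , ≤-trans (s≤s len) h<c , (refl , r) ∷ rs

  accumulateᵣ : ∀ s d → mul s ≤ S →
    Runs (if isOne (just (bit d)) then copy MUL CAR TMP else skip)
      ⟪ record s { tmp = 0 } ⟫ ⟪ record s { tmp = 0 ; car = toℕ d * mul s + car s } ⟫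
  accumulateᵣ s zero       m≤S = skipᵣ
  accumulateᵣ s (suc zero) m≤S =
    subst (λ l → Runs (copy MUL CAR TMP) ⟪ record s { tmp = 0 } ⟫ (⟪ record s { tmp = 0 } ⟫ [ CAR ]%= const l))
      (trans (ones-+ (mul s) (car s) []) (cong (λ n → unary (n + car s)) (sym (+-identityʳ (mul s)))))
      (copyᵣ (mul s) refl refl refl refl m≤S)

  -- The leftover carry is not in binary yet, so the value of the product is stated relative to any
  -- digits `fs` that represent it.
  bitsᵣ : ∀ s c → c ≤ mul s → mul s + mul s ≤ S → ∀ ds → ∃[ ds′ ] ∃[ c′ ]
          c′ ≤ mul s × length ds′ ≡ length ds ×
          (∀ fs → fromDigits fs ≡ c′ → fromDigits (ds′ ++ fs) ≡ c + mul s * fromDigits ds) ×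
          Rounds INP isBit digit (length ds)
            ⟪ record s { inp = map bit ds ; car = c ; tmp = 0 ; flag = 0 } ⟫
            ⟪ record s { inp = [] ; car = c′ ; tmp = 0 ; flag = 0 ; out = map bit ds′ ʳ++ out s } ⟫
  bitsᵣ s c c≤m 2m≤S [] = [] , c , c≤m , refl ,
    (λ fs eq → trans eq (sym (trans (cong (c +_) (*-zeroʳ (mul s))) (+-identityʳ c)))) , []
  bitsᵣ s c c≤m 2m≤S (d ∷ ds)
    with dm+c≤2m ← +-mono-≤ {toℕ d * mul s}
           (≤-trans (*-monoˡ-≤ (mul s) (s≤s⁻¹ (Fin.toℕ<n d))) (≤-reflexive (*-identityˡ (mul s)))) c≤m
    with b , h , c≡ , r ← halveᵣ (record s { inp = map bit ds }) (toℕ d * mul s + c) (≤-trans dm+c≤2m 2m≤S)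
    with ds′ , c′ , c′≤m , len , value , rs ← bitsᵣ (record s { out = bit b ∷ out s }) h
           (half-mono b h (≤-trans (≤-reflexive (sym c≡)) dm+c≤2m)) 2m≤S ds =
    b ∷ ds′ , c′ , c′≤m , cong suc len ,
    (λ fs eq → begin
      toℕ b + fromDigits (ds′ ++ fs) * 2            ≡⟨ cong (λ n → toℕ b + n * 2) (value fs eq) ⟩
      toℕ b + (h + mul s * fromDigits ds) * 2       ≡⟨ distribute (toℕ b) h (mul s) (fromDigits ds) ⟩
      toℕ b + h * 2 + mul s * (fromDigits ds * 2)   ≡⟨ cong (_+ mul s * (fromDigits ds * 2)) (sym c≡) ⟩
      toℕ d * mul s + c + mul s * (fromDigits ds * 2) ≡⟨ collect (toℕ d) (mul s) c (fromDigits ds) ⟩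
      c + mul s * (toℕ d + fromDigits ds * 2)       ∎) ,
    (refl ,
     branchᵣ (accumulateᵣ (record s { inp = map bit (d ∷ ds) ; car = c ; flag = 0 }) d (≤-trans (m≤m+n _ _) 2m≤S)) ⨾ᵣ
     popᵣ ⨾ᵣ r) ∷ rs
    where
    open ≡-Reasoning
    distribute : ∀ b h m v → b + (h + m * v) * 2 ≡ b + h * 2 + m * (v * 2)
    distribute = solve-∀
    collect : ∀ d m c v → d * m + c + m * (v * 2) ≡ c + m * (d + v * 2)
    collect = solve-∀

  AllBits : List Symbol → Set
  AllBits = All (λ a → isBit (just a) ≡ true)

  map-bit-ʳ++ : ∀ ds {v} → AllBits v → AllBits (map bit ds ʳ++ v)
  map-bit-ʳ++ []       vs = vs
  map-bit-ʳ++ (d ∷ ds) vs = map-bit-ʳ++ ds (refl ∷ vs)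

  restoreᵣ : ∀ s ds es → length (ds ++ es) ≤ S →
             Runs (move isBit OUT INP) ⟪ record s { inp = [] ; out = map bit es ʳ++ map bit ds ʳ++ [] } ⟫
                                       ⟪ record s { inp = map bit (ds ++ es) ; out = [] } ⟫
  restoreᵣ s ds es len≤S =
    subst (λ l → Runs (move isBit OUT INP) ⟪ record s { inp = [] ; out = w } ⟫ ⟪ record s { inp = l ; out = [] } ⟫)
      (trans (cong (_ʳ++ []) (sym w≡)) (trans (ʳ++-ʳ++ (map bit (ds ++ es))) (++-identityʳ _)))
      (moveᵣ w (map-bit-ʳ++ es (map-bit-ʳ++ ds [])) refl (sym (++-identityʳ w))
        (≤-trans (≤-reflexive length-w) len≤S))
    where
    w = map bit es ʳ++ map bit ds ʳ++ []
    w≡ : map bit (ds ++ es) ʳ++ [] ≡ w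
    w≡ = trans (cong (_ʳ++ []) (map-++ bit ds es)) (++-ʳ++ (map bit ds))
    length-w : length w ≡ length (ds ++ es)
    length-w = trans (cong length (sym w≡)) (trans (length-ʳ++ (map bit (ds ++ es)))
      (trans (+-identityʳ _) (length-map bit (ds ++ es))))

  -- Abstract: on concrete digits the type checker would otherwise unfold whole runs.
  abstract
    multiplyᵣ : ∀ s ds → mul s + mul s ≤ S → length ds + mul s ≤ S → ∃[ ds′ ]
                fromDigits ds′ ≡ mul s * fromDigits ds × length ds′ ≤ length ds + mul s ×
                Runs multiply ⟪ record s { inp = map bit ds ; car = 0 ; tmp = 0 ; flag = 0 ; out = [] } ⟫
                              ⟪ record s { inp = map bit ds′ ; car = 0 ; tmp = 0 ; flag = 0 ; out = [] } ⟫
    multiplyᵣ s ds 2m≤S len≤S =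
      let ds′ , c , c≤m , len , value , rs = bitsᵣ (record s { out = [] }) 0 z≤n 2m≤S ds
          es , eq , len′ , rs′ = flushᵣ (record s { inp = [] ; out = map bit ds′ ʳ++ [] }) c (<-wellFounded c)
                                   (≤-trans c≤m (≤-trans (m≤m+n _ _) 2m≤S))
          length≤ = ≤-trans (≤-reflexive (length-++ ds′)) (+-mono-≤ (≤-reflexive len) (≤-trans len′ c≤m))
      in ds′ ++ es , value es eq , length≤ ,
         whileᵣ rs refl (≤-trans (m≤m+n (length ds) (mul s)) len≤S) ⨾ᵣ
         whileᵣ rs′ refl (≤-trans len′ (≤-trans c≤m (≤-trans (m≤n+m (mul s) (length ds)) len≤S))) ⨾ᵣ
         restoreᵣ (record s { car = 0 ; tmp = 0 ; flag = 0 }) ds′ es (≤-trans length≤ len≤S)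

-- The factors of the least common multiple

-- The least common multiple is some `q * l`. It divides `m * l`, whence q ≤ m; and q itself
-- satisfies the condition for which `m` is least.
lcm-by-least-factor : ∀ {l i m} .{{_ : NonZero l}} .{{_ : NonZero i}} → 0 < m → i ∣ m * l →
                      (∀ {x} → 0 < x → x < m → ¬ i ∣ x * l) → m * l ≡ lcm l i
lcm-by-least-factor {l} {i} {m} 0<m i∣ml least with m∣lcm[m,n] l i
... | divides q eq = trans (cong (_* l) (≤-antisym m≤q q≤m)) (sym eq)
  where
  q*l∣m*l : q * l ∣ m * l
  q*l∣m*l = subst (_∣ m * l) eq (lcm-least {l} {i} (n∣m*n m) i∣ml)
  q≤m : q ≤ m
  q≤m = *-cancelʳ-≤ q m l (∣⇒≤ {{m*n≢0 m l {{>-nonZero 0<m}}}} q*l∣m*l)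
  0<q : 0 < q
  0<q = n≢0⇒n>0 λ { refl → ≢-nonZero⁻¹ (lcm l i) {{lcm-pos l i}} eq }
  m≤q : m ≤ q
  m≤q = ≮⇒≥ λ q<m → least 0<q q<m (subst (i ∣_) eq (n∣lcm[m,n] l i))

suc-% : ∀ t n → (suc t % suc n ≡ suc (t % suc n) × suc (t % suc n) < suc n) ⊎ (suc t % suc n ≡ 0 × t % suc n ≡ n)
suc-% t n with m≤n⇒m<n∨m≡n (s≤s⁻¹ (m%n<n t (suc n)))
... | inj₁ x<n  = inj₁ (trans (cong (_% suc n) (cong suc (m≡m%n+[m/n]*n t (suc n))))
                         (trans ([m+kn]%n≡m%n (suc (t % suc n)) (t / suc n) (suc n)) (m<n⇒m%n≡m (s≤s x<n))) , s≤s x<n)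
... | inj₂ refl′ = inj₂ (trans (cong (λ x → suc x % suc n) (m≡m%n+[m/n]*n t (suc n)))
                         (trans ([m+kn]%n≡m%n (suc (t % suc n)) (t / suc n) (suc n))
                           (trans (cong (λ x → suc x % suc n) refl′) (n%n≡0 (suc n)))) , refl′)

^-distribʳ-* : ∀ o m n → (m * n) ^ o ≡ m ^ o * n ^ o
^-distribʳ-* zero    m n = refl
^-distribʳ-* (suc o) m n = trans (cong (m * n *_) (^-distribʳ-* o m n)) (interchange m n (m ^ o) (n ^ o))
  where
  interchange : ∀ a b c d → a * b * (c * d) ≡ a * c * (b * d)
  interchange = solve-∀

-- A modular counter without comparisons: the modulus is the sum of `LO` and `HI`, an increment
-- carries a one across, and when `HI` runs empty everything is returned to it.
increment : Program 17
increment = pop HI ▸ push LO one ▸ ifOne HI skip (move isOne LO HI)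

addition : Program 17
addition = pop RES ▸ push TMP one ▸ increment

add : Program 17
add = while RES isOne addition ▸ move isOne TMP RES

-- Every one in a block of `FAC` adds `RES` to the counter, so a block multiplies. At the separator
-- the residue in `LO` becomes the new `RES`; spreading it to `HI` as well resets the counter.
scan : Maybe Symbol → Program 17
scan x = if isOne x then pop FAC ▸ push FAC′ one ▸ add
         else pop FAC ▸ push FAC′ # ▸ clear RES ▸ spread LO RES HI

residue : Program 17
residue = copy CNT HI TMP ▸ push RES one ▸ while FAC nonEmpty (branch FAC scan) ▸ move nonEmpty FAC′ FAC

addMultiple : Program 17
addMultiple = add ▸ push MUL one

-- One multiple is added before the first test, since zero would always pass it.
leastFactor : Program 17
leastFactor = addMultiple ▸ while LO isOne addMultiple ▸ clear HI ▸ clear RES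

multiplyOnce : Program 17
multiplyOnce = pop DEP ▸ push TMP′ one ▸ multiply

-- The power of the least common multiple is accumulated as the product of the powers of its
-- factors, so the least common multiple itself is never written out.
multiplyOften : Program 17
multiplyOften = while DEP isOne multiplyOnce ▸ move isOne TMP′ DEP

location : Program 17
location = pop LOC ▸ push CNT one ▸ residue ▸ leastFactor ▸ push FAC # ▸ copy MUL FAC TMP ▸ multiplyOften ▸ clear MUL

locations : Program 17
locations = while LOC isOne location

factors : List ℕ → List Symbol
factors []       = []
factors (m ∷ ms) = ones m ++ # ∷ factors ms

-- The pair (lo , hi) counts modulo n + 1.
counter : Store → ℕ → ℕ → Store
counter s n t = record s { lo = t % suc n ; hi = suc n ∸ t % suc n }

blank : Store
blank = record
  { inp = [] ; pend = [] ; out = [] ; fac = [] ; fac′ = []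
  ; loc = 0 ; siz = 0 ; dep = 0 ; tmp = 0 ; tmp′ = 0 ; car = 0 ; flag = 0
  ; mul = 0 ; cnt = 0 ; lo = 0 ; hi = 0 ; res = 0
  }

residueOf : ℕ → ℕ → List ℕ → ℕ
residueOf n r []       = r
residueOf n r (m ∷ ms) = residueOf n ((m * r) % suc n) ms

*-%ˡ : ∀ a b n → (a % suc n * b) % suc n ≡ (a * b) % suc n
*-%ˡ a b n = trans (%-distribˡ-* (a % suc n) b (suc n))
  (trans (cong (λ x → (x * (b % suc n)) % suc n) (m%n%n≡m%n a (suc n))) (sym (%-distribˡ-* a b (suc n))))

-- The multiplier `x` stands for the candidates tried in the search; their products with the residue
-- matter only modulo `n + 1`.
residueOf-product : ∀ n r ms x → (x * residueOf n r ms) % suc n ≡ (x * (r * product ms)) % suc n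
residueOf-product n r []       x = cong (λ y → (x * y) % suc n) (sym (*-identityʳ r))
residueOf-product n r (m ∷ ms) x = begin
  (x * residueOf n ((m * r) % suc n) ms) % suc n     ≡⟨ residueOf-product n ((m * r) % suc n) ms x ⟩
  (x * ((m * r) % suc n * product ms)) % suc n       ≡⟨ cong (_% suc n) (rotate x ((m * r) % suc n) (product ms)) ⟩
  ((m * r) % suc n * (x * product ms)) % suc n       ≡⟨ *-%ˡ (m * r) (x * product ms) n ⟩
  (m * r * (x * product ms)) % suc n                 ≡⟨ cong (_% suc n) (rearrange m r x (product ms)) ⟩
  (x * (r * (m * product ms))) % suc n               ∎
  where
  open ≡-Reasoning
  rotate : ∀ x y z → x * (y * z) ≡ y * (x * z)
  rotate = solve-∀
  rearrange : ∀ m r x p → m * r * (x * p) ≡ x * (r * (m * p))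
  rearrange = solve-∀

-- The bound is not strict: without factors the start value is returned unreduced, as happens for 1
-- modulo 1.
residueOf-≤ : ∀ n r ms → r ≤ suc n → residueOf n r ms ≤ suc n
residueOf-≤ n r []       r≤ = r≤
residueOf-≤ n r (m ∷ ms) r≤ = residueOf-≤ n _ ms (<⇒≤ (m%n<n (m * r) (suc n)))

recount : ∀ s {a a′ b b′} → a ≡ a′ → b ≡ b′ → ⟪ record s { lo = a ; hi = b } ⟫ ≡ ⟪ record s { lo = a′ ; hi = b′ } ⟫
recount s refl refl = refl

unary-nonZero : ∀ {m} → m ≢ 0 → isOne (head (unary m)) ≡ true
unary-nonZero {zero}  m≢0 = contradiction refl m≢0
unary-nonZero {suc m} _   = refl

unary-zero : ∀ {m} → m ≡ 0 → isOne (head (unary m)) ≡ false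
unary-zero refl = refl

module Factors (S : ℕ) (3≤S : 3 ≤ S) where
  open Running S 3≤S {17}
  open Macros S 3≤S {17}
  open Multiplication S 3≤S

  module _ (n : ℕ) (n<S : suc n ≤ S) where

    private
      inside : ∀ s x y → Runs increment ⟪ record s { lo = x ; hi = 2 + y } ⟫ ⟪ record s { lo = suc x ; hi = suc y } ⟫
      inside s x y = popᵣ ⨾ᵣ pushᵣ ⨾ᵣ branchᵣ skipᵣ

      wrap : ∀ s → Runs increment ⟪ record s { lo = n ; hi = 1 } ⟫ ⟪ record s { lo = 0 ; hi = suc n } ⟫
      wrap s = popᵣ ⨾ᵣ pushᵣ ⨾ᵣ branchᵣ (moveOnesᵣ (suc n) refl refl n<S)

    incrementᵣ : ∀ s t → Runs increment ⟪ counter s n t ⟫ ⟪ counter s n (suc t) ⟫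
    incrementᵣ s t with suc-% t n
    ... | inj₂ (eq , x≡n) = subst₂ (Runs increment)
      (recount s (sym x≡n) (sym (trans (cong (suc n ∸_) x≡n) (m+n∸n≡m 1 n))))
      (recount s (sym eq) (cong (suc n ∸_) (sym eq))) (wrap s)
    ... | inj₁ (eq , x<n) with y , eq′ ← m≤n⇒∃[o]m+o≡n (s≤s⁻¹ x<n) = subst₂ (Runs increment)
      (recount s refl (sym (trans (cong (_∸ x) (trans (cong suc (sym eq′)) (rearrange x y))) (m+n∸n≡m (2 + y) x))))
      (recount s (sym eq)
        (sym (trans (cong₂ _∸_ (trans (cong suc (sym eq′)) (rearrange′ x y)) eq) (m+n∸n≡m (suc y) (suc x)))))
      (inside s x y)
      where
      x = t % suc n
      rearrange : ∀ x y → 2 + x + y ≡ 2 + y + x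
      rearrange = solve-∀
      rearrange′ : ∀ x y → 2 + x + y ≡ 1 + y + (1 + x)
      rearrange′ = solve-∀

    addᵣ : ∀ s t r → r ≤ S → Runs add ⟪ record (counter s n t) { res = r ; tmp = 0 } ⟫
                                      ⟪ record (counter s n (r + t)) { res = r ; tmp = 0 } ⟫
    addᵣ s t r r≤S = whileᵣ (rounds r t 0) refl r≤S ⨾ᵣ
      moveOnesᵣ r refl (cong unary (+-identityʳ r)) r≤S
      where
      rounds : ∀ r t a → Rounds RES isOne addition r
                 ⟪ record (counter s n t) { res = r ; tmp = a } ⟫
                 ⟪ record (counter s n (r + t)) { res = 0 ; tmp = r + a } ⟫
      rounds zero    t a = []
      rounds (suc r) t a = (refl , popᵣ ⨾ᵣ pushᵣ ⨾ᵣ incrementᵣ (record s { res = r ; tmp = suc a }) t) ∷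
        subst₂ (λ x y → Rounds RES isOne addition r
                 ⟪ record (counter s n (suc t)) { res = r ; tmp = suc a } ⟫
                 ⟪ record (counter s n x) { res = 0 ; tmp = y } ⟫)
          (+-suc r t) (+-suc r a) (rounds r (suc t) (suc a))

    private
      scanning : Store → ℕ → ℕ → List Symbol → List Symbol → Store
      scanning s t r v w = record (counter s n t) { res = r ; tmp = 0 ; fac = v ; fac′ = w }

      scan-ones : ∀ s t r m v w → r ≤ S → Rounds FAC nonEmpty (branch FAC scan) m
                    ⟪ scanning s t r (ones m ++ v) w ⟫ ⟪ scanning s (m * r + t) r v (ones m ʳ++ w) ⟫
      scan-ones s t r zero    v w r≤S = []
      scan-ones s t r (suc m) v w r≤S =
        (refl , branchᵣ (popᵣ ⨾ᵣ pushᵣ ⨾ᵣ addᵣ (record s { fac = ones m ++ v ; fac′ = one ∷ w }) t r r≤S)) ∷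
        subst (λ x → Rounds FAC nonEmpty (branch FAC scan) m
                       ⟪ scanning s (r + t) r (ones m ++ v) (one ∷ w) ⟫ ⟪ scanning s x r v (ones m ʳ++ one ∷ w) ⟫)
          (rearrange (m * r) r t) (scan-ones s (r + t) r m v (one ∷ w) r≤S)
        where
        rearrange : ∀ x r t → x + (r + t) ≡ r + x + t
        rearrange = solve-∀

      scan-# : ∀ s t r v w → r ≤ S → Runs (branch FAC scan) ⟪ scanning s t r (# ∷ v) w ⟫
                                                            ⟪ scanning s 0 (t % suc n) v (# ∷ w) ⟫
      scan-# s t r v w r≤S = branchᵣ (popᵣ ⨾ᵣ pushᵣ ⨾ᵣ clearᵣ r refl refl r≤S ⨾ᵣ
        subst (λ l → Runs (spread LO RES HI) ⟪ scanning s t 0 v (# ∷ w) ⟫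
                       (⟪ scanning s 0 (t % suc n) v (# ∷ w) ⟫ [ HI ]%= const l))
          (trans (ones-+ x (suc n ∸ x) []) (cong unary (m+[n∸m]≡n (<⇒≤ (m%n<n t (suc n))))))
          (spreadᵣ x refl refl (≤-trans (<⇒≤ (m%n<n t (suc n))) n<S)))
        where x = t % suc n

      scan-factors : ∀ s r ms w → r ≤ S → Rounds FAC nonEmpty (branch FAC scan) (length (factors ms))
                       ⟪ scanning s 0 r (factors ms) w ⟫ ⟪ scanning s 0 (residueOf n r ms) [] (factors ms ʳ++ w) ⟫
      scan-factors s r []       w r≤S = []
      scan-factors s r (m ∷ ms) w r≤S =
        subst₂ (λ l x → Rounds FAC nonEmpty (branch FAC scan) l ⟪ scanning s 0 r (factors (m ∷ ms)) w ⟫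
                          ⟪ scanning s 0 (residueOf n r (m ∷ ms)) [] x ⟫)
          (sym (trans (length-++ (ones m)) (cong (_+ suc (length (factors ms))) (length-ones m))))
          (sym (++-ʳ++ (ones m)))
          (scan-ones s 0 r m (# ∷ factors ms) w r≤S ++ᵣ
           (refl , scan-# s (m * r + 0) r (factors ms) (ones m ʳ++ w) r≤S) ∷
           subst (λ x → Rounds FAC nonEmpty (branch FAC scan) (length (factors ms))
                          ⟪ scanning s 0 x (factors ms) (# ∷ ones m ʳ++ w) ⟫
                          ⟪ scanning s 0 (residueOf n r (m ∷ ms)) [] (factors ms ʳ++ # ∷ ones m ʳ++ w) ⟫)
             (cong (_% suc n) (sym (+-identityʳ (m * r))))
             (scan-factors s ((m * r) % suc n) ms (# ∷ ones m ʳ++ w) (≤-trans (<⇒≤ (m%n<n (m * r) (suc n))) n<S)))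

    residueᵣ : ∀ s ms → length (factors ms) ≤ S →
      let s′ = record s { cnt = suc n ; lo = 0 ; tmp = 0 ; fac = factors ms ; fac′ = [] } in
      Runs residue ⟪ record s′ { hi = 0 ; res = 0 } ⟫ ⟪ record s′ { hi = suc n ; res = residueOf n 1 ms } ⟫
    residueᵣ s ms len = copyᵣ (suc n) refl refl refl refl n<S ⨾ᵣ pushᵣ ⨾ᵣ
      whileᵣ (scan-factors s′ 1 ms [] (≤-trans (s≤s z≤n) 3≤S)) refl len ⨾ᵣ
      subst (λ x → Runs (move nonEmpty FAC′ FAC) ⟪ scanning s′ 0 (residueOf n 1 ms) [] w ⟫
                                                 ⟪ scanning s′ 0 (residueOf n 1 ms) x [] ⟫)
        (trans (ʳ++-ʳ++ (factors ms)) (++-identityʳ (factors ms)))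
        (moveᵣ w (All.universal (λ _ → refl) w) refl (sym (++-identityʳ w))
          (≤-trans (≤-reflexive (trans (length-ʳ++ (factors ms)) (+-identityʳ _))) len))
      where
      s′ = record s { cnt = suc n }
      w = factors ms ʳ++ []

    private
      searching : Store → ℕ → ℕ → Store
      searching s r j = record (counter s n (j * r)) { res = r ; tmp = 0 ; mul = j }

      addMultipleᵣ : ∀ s r j → r ≤ S → Runs addMultiple ⟪ searching s r j ⟫ ⟪ searching s r (suc j) ⟫
      addMultipleᵣ s r j r≤S = addᵣ (record s { mul = j }) (j * r) r r≤S ⨾ᵣ pushᵣ

      search : ∀ s r → r ≤ S → ∀ j d → j + d ≡ suc n → ∃[ m ] j ≤ m × m ≤ suc n × (m * r) % suc n ≡ 0 ×
               (∀ {x} → j ≤ x → x < m → (x * r) % suc n ≢ 0) ×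
               (∃[ c ] c ≤ d × Rounds LO isOne addMultiple c ⟪ searching s r j ⟫ ⟪ searching s r m ⟫)
      search s r r≤S j d j+d≡ with (j * r) % suc n ≟ 0
      ... | yes ≡0 = j , ≤-refl , ≤-trans (m≤m+n j d) (≤-reflexive j+d≡) , ≡0 ,
        (λ j≤x x<j → contradiction j≤x (<⇒≱ x<j)) , 0 , z≤n , []
      -- Here `j` has reached the modulus, and multiplying by the modulus always gives residue zero.
      search s r r≤S j zero j+0≡ | no ≢0 =
        contradiction (trans (cong (_% suc n)
          (trans (cong (_* r) (trans (sym (+-identityʳ j)) j+0≡)) (*-comm (suc n) r))) (m*n%n≡0 r (suc n))) ≢0
      search s r r≤S j (suc d) j+d≡ | no ≢0
        with m , j<m , m≤ , ≡0 , least , c , c≤ , rs ← search s r r≤S (suc j) d (trans (sym (+-suc j d)) j+d≡) =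
        m , <⇒≤ j<m , m≤ , ≡0 ,
        (λ {x} j≤x x<m → [ (λ j<x → least j<x x<m) , (λ { refl → ≢0 }) ]′ (m≤n⇒m<n∨m≡n j≤x)) ,
        suc c , s≤s c≤ , (unary-nonZero ≢0 , addMultipleᵣ s r j r≤S) ∷ rs

    leastFactorᵣ : ∀ s r → r ≤ S → ∃[ m ] 0 < m × m ≤ suc n × (m * r) % suc n ≡ 0 ×
      (∀ {x} → 0 < x → x < m → (x * r) % suc n ≢ 0) ×
      Runs leastFactor ⟪ record s { lo = 0 ; hi = suc n ; res = r ; tmp = 0 ; mul = 0 } ⟫
                       ⟪ record s { lo = 0 ; hi = 0 ; res = 0 ; tmp = 0 ; mul = m } ⟫
    leastFactorᵣ s r r≤S with m , 0<m , m≤ , ≡0 , least , c , c≤ , rs ← search s r r≤S 1 n refl =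
      m , 0<m , m≤ , ≡0 , least ,
      addMultipleᵣ s r 0 r≤S ⨾ᵣ
      whileᵣ rs (unary-zero ≡0) (≤-trans c≤ (≤-trans (n≤1+n n) n<S)) ⨾ᵣ
      subst (λ σ → Runs (clear HI) ⟪ searching s r m ⟫ (σ [ HI ]%= const []))
        (recount (record s { res = r ; tmp = 0 ; mul = m }) {b = suc n ∸ (m * r) % suc n} ≡0 refl)
        (clearᵣ (suc n ∸ (m * r) % suc n) refl refl (≤-trans (m∸n≤m (suc n) ((m * r) % suc n)) n<S)) ⨾ᵣ
      clearᵣ r refl refl r≤S

  timesᵣ : ∀ s → mul s + mul s ≤ S → ∀ d f ds → length ds + d * mul s ≤ S → ∃[ ds′ ]
    fromDigits ds′ ≡ mul s ^ d * fromDigits ds × length ds′ ≤ length ds + d * mul s ×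
    Rounds DEP isOne multiplyOnce d
      ⟪ record s { inp = map bit ds ; dep = d ; tmp′ = f ; car = 0 ; tmp = 0 ; flag = 0 ; out = [] } ⟫
      ⟪ record s { inp = map bit ds′ ; dep = 0 ; tmp′ = d + f ; car = 0 ; tmp = 0 ; flag = 0 ; out = [] } ⟫
  timesᵣ s 2m≤S zero    f ds len≤S = ds , sym (*-identityˡ (fromDigits ds)) , m≤m+n (length ds) 0 , []
  timesᵣ s 2m≤S (suc d) f ds len≤S =
    let len₁≤S = ≤-trans (+-monoʳ-≤ (length ds) (m≤m+n (mul s) (d * mul s))) len≤S
        ds₁ , value₁ , len₁ , r = multiplyᵣ (record s { dep = d ; tmp′ = suc f }) ds 2m≤S len₁≤S
        total = ≤-trans (+-monoˡ-≤ (d * mul s) len₁) (≤-reflexive (+-assoc (length ds) (mul s) (d * mul s)))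
        ds₂ , value₂ , len₂ , rs = timesᵣ s 2m≤S d (suc f) ds₁ (≤-trans total len≤S)
    in ds₂ , trans value₂ (trans (cong (mul s ^ d *_) value₁) (regroup (mul s ^ d) (mul s) (fromDigits ds))) ,
       ≤-trans len₂ total ,
       (refl , popᵣ ⨾ᵣ pushᵣ ⨾ᵣ r) ∷
       subst (λ x → Rounds DEP isOne multiplyOnce d
         ⟪ record s { inp = map bit ds₁ ; dep = d ; tmp′ = suc f ; car = 0 ; tmp = 0 ; flag = 0 ; out = [] } ⟫
         ⟪ record s { inp = map bit ds₂ ; dep = 0 ; tmp′ = x ; car = 0 ; tmp = 0 ; flag = 0 ; out = [] } ⟫) (+-suc d f) rs
    where
    regroup : ∀ p m v → p * (m * v) ≡ m * p * v
    regroup = solve-∀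

  multiplyOftenᵣ : ∀ s d ds → mul s + mul s ≤ S → length ds + d * mul s ≤ S → d ≤ S → ∃[ ds′ ]
    fromDigits ds′ ≡ mul s ^ d * fromDigits ds × length ds′ ≤ length ds + d * mul s ×
    Runs multiplyOften
      ⟪ record s { inp = map bit ds ; dep = d ; tmp′ = 0 ; car = 0 ; tmp = 0 ; flag = 0 ; out = [] } ⟫
      ⟪ record s { inp = map bit ds′ ; dep = d ; tmp′ = 0 ; car = 0 ; tmp = 0 ; flag = 0 ; out = [] } ⟫
  multiplyOftenᵣ s d ds 2m≤S len≤S d≤S with ds′ , value , len , rs ← timesᵣ s 2m≤S d 0 ds len≤S =
    ds′ , value , len , whileᵣ rs refl d≤S ⨾ᵣ moveOnesᵣ d refl (cong unary (+-identityʳ d)) d≤S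

  main : ℕ → ℕ → ℕ → List ℕ → Expansion 2 → Store
  main l d n ms ds = record blank { inp = map bit ds ; fac = factors ms ; loc = l ; dep = d ; cnt = n }

  locationᵣ : ∀ l d n ms ds → product ms ≡ lcmUpTo n → suc n + suc n ≤ S → length (factors ms) ≤ S →
              length ds + d * suc n ≤ S → d ≤ S → ∃[ m ] ∃[ ds′ ]
              m ≤ suc n × m * lcmUpTo n ≡ lcmUpTo (suc n) ×
              fromDigits ds′ ≡ m ^ d * fromDigits ds × length ds′ ≤ length ds + d * suc n ×
              Runs location ⟪ main (suc l) d n ms ds ⟫ ⟪ main l d (suc n) (m ∷ ms) ds′ ⟫
  locationᵣ l d n ms ds Π≡ 2n≤S factors≤S len≤S d≤S =
    let n<S = ≤-trans (m≤m+n (suc n) (suc n)) 2n≤S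
        m , 0<m , m≤ , ≡0 , least , r = leastFactorᵣ n n<S (main l d (suc n) ms ds) (residueOf n 1 ms)
                                          (≤-trans (residueOf-≤ n 1 ms (s≤s z≤n)) n<S)
        m≤S = ≤-trans m≤ n<S
        ds′ , value , len , r′ = multiplyOftenᵣ (record (main l d (suc n) (m ∷ ms) ds) { mul = m }) d ds
           (≤-trans (+-mono-≤ m≤ m≤) 2n≤S) (≤-trans (+-monoʳ-≤ (length ds) (*-monoʳ-≤ d m≤)) len≤S) d≤S
    in m , ds′ , m≤ ,
       trans (lcm-by-least-factor {{LCM-nonZero (upTo n)}} 0<m (m%n≡0⇒n∣m _ _ (trans (congruent m) ≡0))
               (λ {x} 0<x x<m i∣ → least 0<x x<m (trans (sym (congruent x)) (n∣m⇒m%n≡0 _ _ i∣))))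
         (sym (lcmUpTo-suc n)) ,
       value , ≤-trans len (+-monoʳ-≤ (length ds) (*-monoʳ-≤ d m≤)) ,
       popᵣ ⨾ᵣ pushᵣ ⨾ᵣ residueᵣ n n<S (main l d (suc n) ms ds) ms factors≤S ⨾ᵣ r ⨾ᵣ pushᵣ ⨾ᵣ
       copyᵣ m refl refl refl refl m≤S ⨾ᵣ r′ ⨾ᵣ clearᵣ m refl refl m≤S
    where
    congruent : ∀ x → (x * lcmUpTo n) % suc n ≡ (x * residueOf n 1 ms) % suc n
    congruent x = sym (trans (residueOf-product n 1 ms x)
      (cong (λ p → (x * p) % suc n) (trans (*-identityˡ (product ms)) Π≡)))

  -- The length hypotheses are budgets for the `l` rounds to come: each adds a block of at most `k`
  -- ones with its separator to the factors, and at most `d * k` digits to the number.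
  locationsᵣ : ∀ l d n ms ds k v → n + l ≡ k → product ms ≡ lcmUpTo n → k + k ≤ S → d ≤ S →
               length (factors ms) + l * suc k ≤ S → length ds + l * (d * k) ≤ S →
               fromDigits ds ≡ v * lcmUpTo n ^ d → ∃[ ms′ ] ∃[ ds′ ]
               fromDigits ds′ ≡ v * lcmUpTo k ^ d ×
               Rounds LOC isOne location l ⟪ main l d n ms ds ⟫ ⟪ main 0 d k ms′ ds′ ⟫
  locationsᵣ zero    d n ms ds k v n≡k Π≡ 2k≤S d≤S factors≤S len≤S value
    with refl ← trans (sym (+-identityʳ n)) n≡k = ms , ds , value , []
  locationsᵣ (suc l) d n ms ds k v n+l≡k Π≡ 2k≤S d≤S factors≤S len≤S value =
    let n<k = subst (suc n ≤_) (trans (sym (+-suc n l)) n+l≡k) (m≤m+n (suc n) l)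
        m , ds₁ , m≤ , m*≡ , value₁ , len₁ , r = locationᵣ l d n ms ds Π≡
          (≤-trans (+-mono-≤ n<k n<k) 2k≤S) (≤-trans (m≤m+n _ _) factors≤S)
          (≤-trans (+-monoʳ-≤ (length ds) (≤-trans (*-monoʳ-≤ d n<k) (m≤m+n (d * k) _))) len≤S) d≤S
        ms′ , ds′ , value′ , rs = locationsᵣ l d (suc n) (m ∷ ms) ds₁ k v (trans (sym (+-suc n l)) n+l≡k)
          (trans (cong (m *_) Π≡) m*≡) 2k≤S d≤S
          (≤-trans (≤-trans (+-monoˡ-≤ (l * suc k)
              (≤-trans (≤-reflexive (trans (length-++ (ones m)) (cong (_+ suc (length (factors ms))) (length-ones m))))
                       (+-monoˡ-≤ (suc (length (factors ms))) (≤-trans m≤ n<k))))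
              (≤-reflexive (regroup k (length (factors ms)) (l * suc k)))) factors≤S)
          (≤-trans (≤-trans (+-monoˡ-≤ (l * (d * k)) (≤-trans len₁ (+-monoʳ-≤ (length ds) (*-monoʳ-≤ d n<k))))
              (≤-reflexive (+-assoc (length ds) (d * k) (l * (d * k))))) len≤S)
          (trans value₁ (trans (cong (m ^ d *_) value) (trans (exchange (m ^ d) v (lcmUpTo n ^ d))
            (cong (v *_) (trans (sym (^-distribʳ-* d m (lcmUpTo n))) (cong (_^ d) m*≡))))))
    in ms′ , ds′ , value′ , (refl , r) ∷ rs
    where
    regroup : ∀ k f x → k + (1 + f) + x ≡ f + (1 + k + x)
    regroup = solve-∀
    exchange : ∀ p v q → p * (v * q) ≡ v * (p * q)
    exchange = solve-∀

-- Reading the input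

skipTables : Program 17
skipTables = while INP not$ (pop INP) ▸ pop INP

duplicate : Program 17
duplicate = copy PEND TMP′ TMP ▸ push PEND # ▸ move isOne TMP′ PEND

deepen : Program 17
deepen = pop PEND ▸ push TMP one ▸ pop DEP

-- A maximum without comparison: popping an empty stack has no effect, so the loop performs a
-- truncated subtraction of the depth from `DEP`, and adding the depth back yields the larger of the
-- two.
leaf : Program 17
leaf = while PEND isOne deepen ▸ move isOne TMP DEP ▸ pop PEND

skipName : Program 17
skipName = while INP isBit (pop INP) ▸ pop INP

node : Program 17
node = pop INP ▸ push SIZ one

-- After `duplicate` the upper copy of the depth belongs to the left argument, which is read first;
-- an until increases that copy only.
token : Maybe Symbol → Program 17
token (just at)  = node ▸ skipName ▸ leaf
token (just not) = node
token (just and) = node ▸ duplicate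
token (just ex)  = node
token (just eu)  = node ▸ duplicate ▸ push PEND one
token (just ew)  = node ▸ duplicate ▸ push PEND one
token _          = skip

-- A depth-first traversal of the syntax tree: PEND holds, in unary and separated by #,
-- the leftward until depths at which the subformulas still to be read occur.
formula : Program 17
formula = while INP nonEmpty (branch INP token)

square : Program 17
square = multiply ▸ multiply

-- The zero pushed last is a new least significant bit and supplies the factor 2.
scale : Program 17
scale = copy LOC MUL TMP ▸ square ▸ clear MUL ▸
        move isOne SIZ MUL ▸ multiply ▸ clear MUL ▸
        push INP (bit 0b)

compute : Program 17
compute = move isOne INP LOC ▸ skipTables ▸
          -- The lone separator encodes depth zero, at which the whole formula occurs.
          push PEND # ▸ formula ▸
          push INP one ▸ scale ▸ locations

n+[m∸n]≡m⊔n : ∀ m n → n + (m ∸ n) ≡ m ⊔ n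
n+[m∸n]≡m⊔n m       zero    = sym (⊔-identityʳ m)
n+[m∸n]≡m⊔n zero    (suc n) = +-identityʳ (suc n)
n+[m∸n]≡m⊔n (suc m) (suc n) = cong suc (n+[m∸n]≡m⊔n m n)

move-suc : ∀ d l → suc d + l ≡ d + (l + 1)
move-suc d l = trans (sym (+-suc d l)) (cong (d +_) (+-comm 1 l))

deepest : ∀ m d l l′ → m ⊔ (suc d + l) ⊔ (d + l′) ≡ m ⊔ (d + ((l + 1) ⊔ l′))
deepest m d l l′ = trans (⊔-assoc m (suc d + l) (d + l′))
  (cong (m ⊔_) (trans (cong (_⊔ (d + l′)) (move-suc d l)) (sym (+-distribˡ-⊔ d (l + 1) l′))))

module Reading (S : ℕ) (3≤S : 3 ≤ S) {P : Set} (countable : P ↣ ℕ) where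
  open Running S 3≤S {17}
  open Macros S 3≤S {17}
  open Encoding countable

  popsᵣ : ∀ {b} s w v → All (λ a → b (just a) ≡ true) w →
          Rounds INP b (pop INP) (length w) ⟪ record s { inp = w ++ v } ⟫ ⟪ record s { inp = v } ⟫
  popsᵣ s []      v []        = []
  popsᵣ s (a ∷ w) v (ba ∷ bs) = (ba , popᵣ) ∷ popsᵣ s w v bs

  duplicateᵣ : ∀ s d v → d ≤ S →
    Runs duplicate ⟪ record s { pend = ones d ++ # ∷ v ; tmp = 0 ; tmp′ = 0 } ⟫
                   ⟪ record s { pend = ones d ++ # ∷ ones d ++ # ∷ v ; tmp = 0 ; tmp′ = 0 } ⟫
  duplicateᵣ s d v d≤S = copyᵣ d refl refl refl refl d≤S ⨾ᵣ pushᵣ ⨾ᵣ moveOnesᵣ d refl refl d≤S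

  leafᵣ : ∀ s d v → d ≤ S → Runs leaf ⟪ record s { pend = ones d ++ # ∷ v ; tmp = 0 } ⟫
                                      ⟪ record s { pend = v ; tmp = 0 ; dep = dep s ⊔ d } ⟫
  leafᵣ s d v d≤S = whileᵣ (rounds d (dep s) 0) refl d≤S ⨾ᵣ
    subst (λ l → Runs (move isOne TMP DEP) ⟪ record s { pend = # ∷ v ; tmp = d + 0 ; dep = dep s ∸ d } ⟫
                   (⟪ record s { pend = # ∷ v ; tmp = 0 } ⟫ [ DEP ]%= const l))
      (trans (ones-+ d (dep s ∸ d) []) (cong unary (n+[m∸n]≡m⊔n (dep s) d)))
      (moveOnesᵣ d refl (cong unary (+-identityʳ d)) d≤S) ⨾ᵣ
    popᵣ
    where
    rounds : ∀ d m t → Rounds PEND isOne deepen d ⟪ record s { pend = ones d ++ # ∷ v ; tmp = t ; dep = m } ⟫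
                                                  ⟪ record s { pend = # ∷ v ; tmp = d + t ; dep = m ∸ d } ⟫
    rounds zero    m t = []
    rounds (suc d) m t = (refl , popᵣ ⨾ᵣ pushᵣ ⨾ᵣ decrement m) ∷
      subst₂ (λ x y → Rounds PEND isOne deepen d ⟪ record s { pend = ones d ++ # ∷ v ; tmp = suc t ; dep = m ∸ 1 } ⟫
                                                 ⟪ record s { pend = # ∷ v ; tmp = x ; dep = y } ⟫)
        (+-suc d t) (∸-+-assoc m 1 d) (rounds d (m ∸ 1) (suc t))
      where
      decrement : ∀ m → Runs (pop DEP) ⟪ record s { pend = ones d ++ # ∷ v ; tmp = suc t ; dep = m } ⟫
                                       ⟪ record s { pend = ones d ++ # ∷ v ; tmp = suc t ; dep = m ∸ 1 } ⟫
      decrement zero    = popᵣ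
      decrement (suc m) = popᵣ

  reading : ℕ → List Symbol → List Symbol → ℕ → ℕ → Store
  reading k u p z m = record blank { loc = k ; inp = u ; pend = p ; siz = z ; dep = m }

  nodeᵣ : ∀ {k a u p z m} → Runs node ⟪ reading k (a ∷ u) p z m ⟫ ⟪ reading k u p (suc z) m ⟫
  nodeᵣ = popᵣ ⨾ᵣ pushᵣ

  allBits : ∀ ds → All (λ a → isBit (just a) ≡ true) (map bit ds)
  allBits []       = []
  allBits (d ∷ ds) = refl ∷ allBits ds

  skipNameᵣ : ∀ s p w → length (name p) ≤ S →
              Runs skipName ⟪ record s { inp = name p ++ w } ⟫ ⟪ record s { inp = w } ⟫
  skipNameᵣ s p w len =
    subst (λ u → Runs skipName ⟪ record s { inp = u } ⟫ ⟪ record s { inp = w } ⟫) (sym (++-assoc bits (# ∷ []) w))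
      (whileᵣ (popsᵣ s bits (# ∷ w) (allBits (proj₁ (toDigits 2 (Injection.to countable p))))) refl
        (≤-trans (≤-trans (m≤m+n (length bits) 1) (≤-reflexive (sym (length-++ bits)))) len) ⨾ᵣ popᵣ)
    where bits = map bit (proj₁ (toDigits 2 (Injection.to countable p)))

  adjust : ∀ {σ k c c′ w v z z′ m m′} → c ≡ c′ → z ≡ z′ → m ≡ m′ →
           Rounds INP nonEmpty (branch INP token) c σ ⟪ reading k w v z m ⟫ →
           Rounds INP nonEmpty (branch INP token) c′ σ ⟪ reading k w v z′ m′ ⟫
  adjust refl refl refl rs = rs

  -- Each round reads one node, hence `size φ` rounds. The induction needs arbitrary remaining input
  -- `w` and pending depths `v`, and arbitrary values `z` and `m` of the node count and of the
  -- maximum so far.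
  formulaᵣ : ∀ φ k w d v z m → length (ctl φ) ≤ S → d + lud φ ≤ S →
             Rounds INP nonEmpty (branch INP token) (size φ)
               ⟪ reading k (ctl φ ++ w) (ones d ++ # ∷ v) z m ⟫
               ⟪ reading k w v (size φ + z) (m ⊔ (d + lud φ)) ⟫
  -- The common part of the three binary connectives; `d′` is `d` for a conjunction and `suc d` for
  -- the two untils.
  left-rightᵣ : ∀ φ ψ d′ k w d v z m {a} → length (ctl φ ++ ctl ψ) ≤ S → d′ + lud φ ≤ S → d + lud ψ ≤ S →
                Runs (token (just a)) ⟪ reading k (a ∷ ctl φ ++ ctl ψ ++ w) (ones d ++ # ∷ v) z m ⟫
                  ⟪ reading k (ctl φ ++ ctl ψ ++ w) (ones d′ ++ # ∷ ones d ++ # ∷ v) (suc z) m ⟫ →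
                Rounds INP nonEmpty (branch INP token) (size φ + size ψ + 1)
                  ⟪ reading k (a ∷ (ctl φ ++ ctl ψ) ++ w) (ones d ++ # ∷ v) z m ⟫
                  ⟪ reading k w v (size φ + size ψ + 1 + z) (m ⊔ (d′ + lud φ) ⊔ (d + lud ψ)) ⟫
  formulaᵣ (atom p) k w d v z m len d≤S =
    (refl , branchᵣ (nodeᵣ ⨾ᵣ
      skipNameᵣ (reading k [] (ones d ++ # ∷ v) (suc z) m) p w (≤-trans (n≤1+n _) len) ⨾ᵣ
      leafᵣ (reading k w [] (suc z) m) d v (≤-trans (m≤m+n d 0) d≤S))) ∷
    adjust refl refl (cong (m ⊔_) (sym (+-identityʳ d))) []
  formulaᵣ (¬′ φ) k w d v z m len d≤S =
    adjust (+-comm 1 (size φ)) (rearrange (size φ) z) refl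
      ((refl , branchᵣ nodeᵣ) ∷ formulaᵣ φ k w d v (suc z) m (≤-trans (n≤1+n _) len) d≤S)
    where
    rearrange : ∀ x z → x + (1 + z) ≡ x + 1 + z
    rearrange = solve-∀
  formulaᵣ (EX φ) k w d v z m len d≤S =
    adjust (+-comm 1 (size φ)) (rearrange (size φ) z) refl
      ((refl , branchᵣ nodeᵣ) ∷ formulaᵣ φ k w d v (suc z) m (≤-trans (n≤1+n _) len) d≤S)
    where
    rearrange : ∀ x z → x + (1 + z) ≡ x + 1 + z
    rearrange = solve-∀
  formulaᵣ (φ ∧′ ψ) k w d v z m len d≤S =
    adjust refl refl (trans (⊔-assoc m (d + lud φ) (d + lud ψ)) (cong (m ⊔_) (sym (+-distribˡ-⊔ d (lud φ) (lud ψ)))))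
      (left-rightᵣ φ ψ d k w d v z m (≤-trans (n≤1+n _) len)
        (≤-trans (+-monoʳ-≤ d (m≤m⊔n (lud φ) (lud ψ))) d≤S) (≤-trans (+-monoʳ-≤ d (m≤n⊔m (lud φ) (lud ψ))) d≤S)
        (nodeᵣ ⨾ᵣ duplicateᵣ (reading k (ctl φ ++ ctl ψ ++ w) [] (suc z) m) d v (≤-trans (m≤m+n d _) d≤S)))
  formulaᵣ (E φ U ψ) k w d v z m len d≤S =
    adjust refl refl (deepest m d (lud φ) (lud ψ))
      (left-rightᵣ φ ψ (suc d) k w d v z m (≤-trans (n≤1+n _) len)
        (≤-trans (≤-trans (≤-reflexive (move-suc d (lud φ))) (+-monoʳ-≤ d (m≤m⊔n (lud φ + 1) (lud ψ)))) d≤S)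
        (≤-trans (+-monoʳ-≤ d (m≤n⊔m (lud φ + 1) (lud ψ))) d≤S)
        (nodeᵣ ⨾ᵣ duplicateᵣ (reading k (ctl φ ++ ctl ψ ++ w) [] (suc z) m) d v (≤-trans (m≤m+n d _) d≤S) ⨾ᵣ pushᵣ))
  formulaᵣ (E φ WU ψ) k w d v z m len d≤S =
    adjust refl refl (deepest m d (lud φ) (lud ψ))
      (left-rightᵣ φ ψ (suc d) k w d v z m (≤-trans (n≤1+n _) len)
        (≤-trans (≤-trans (≤-reflexive (move-suc d (lud φ))) (+-monoʳ-≤ d (m≤m⊔n (lud φ + 1) (lud ψ)))) d≤S)
        (≤-trans (+-monoʳ-≤ d (m≤n⊔m (lud φ + 1) (lud ψ))) d≤S)
        (nodeᵣ ⨾ᵣ duplicateᵣ (reading k (ctl φ ++ ctl ψ ++ w) [] (suc z) m) d v (≤-trans (m≤m+n d _) d≤S) ⨾ᵣ pushᵣ))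
  left-rightᵣ φ ψ d′ k w d v z m {a} len d′≤S d≤S r =
    adjust (+-comm 1 (size φ + size ψ)) (rearrange (size φ) (size ψ) z) refl
      ((refl , branchᵣ (subst (λ u → Runs (token (just a)) ⟪ reading k (a ∷ u) (ones d ++ # ∷ v) z m ⟫
          ⟪ reading k (ctl φ ++ ctl ψ ++ w) (ones d′ ++ # ∷ ones d ++ # ∷ v) (suc z) m ⟫)
          (sym (++-assoc (ctl φ) (ctl ψ) w)) r)) ∷
       (formulaᵣ φ k (ctl ψ ++ w) d′ (ones d ++ # ∷ v) (suc z) m
          (≤-trans (≤-trans (m≤m+n (length (ctl φ)) _) (≤-reflexive (sym (length-++ (ctl φ))))) len) d′≤S ++ᵣ
        formulaᵣ ψ k w d v (size φ + suc z) (m ⊔ (d′ + lud φ))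
          (≤-trans (≤-trans (m≤n+m (length (ctl ψ)) _) (≤-reflexive (sym (length-++ (ctl φ))))) len) d≤S))
    where
    rearrange : ∀ x y z → y + (x + (1 + z)) ≡ x + y + 1 + z
    rearrange = solve-∀

-- The factor 2 ∣φ∣ k² and the total running time

module Scaling (S : ℕ) (3≤S : 3 ≤ S) where
  open Running S 3≤S {17}
  open Macros S 3≤S {17}
  open Multiplication S 3≤S
  open Factors S 3≤S

  squareᵣ : ∀ s ds → mul s + mul s ≤ S → length ds + mul s + mul s ≤ S → ∃[ ds′ ]
            fromDigits ds′ ≡ mul s * (mul s * fromDigits ds) × length ds′ ≤ length ds + mul s + mul s ×
            Runs square ⟪ record s { inp = map bit ds ; car = 0 ; tmp = 0 ; flag = 0 ; out = [] } ⟫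
                        ⟪ record s { inp = map bit ds′ ; car = 0 ; tmp = 0 ; flag = 0 ; out = [] } ⟫
  squareᵣ s ds 2m≤S len≤S =
    let ds₁ , value₁ , len₁ , r₁ = multiplyᵣ s ds 2m≤S (≤-trans (m≤m+n _ (mul s)) len≤S)
        ds₂ , value₂ , len₂ , r₂ = multiplyᵣ s ds₁ 2m≤S (≤-trans (+-monoˡ-≤ (mul s) len₁) len≤S)
    in ds₂ , trans value₂ (cong (mul s *_) value₁) , ≤-trans len₂ (+-monoˡ-≤ (mul s) len₁) , r₁ ⨾ᵣ r₂

  abstract
    scaleᵣ : ∀ k z d → k + k ≤ S → z + z ≤ S → 2 + (k + k + z) ≤ S → ∃[ ds ]
             fromDigits ds ≡ z * (k * (k * 1)) * 2 × length ds ≤ 2 + (k + k + z) ×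
             Runs scale ⟪ record blank { inp = one ∷ [] ; loc = k ; siz = z ; dep = d } ⟫ ⟪ main k d 0 [] ds ⟫
    scaleᵣ k z d 2k≤S 2z≤S len≤S =
      let k≤S = ≤-trans (m≤m+n k k) 2k≤S
          z≤S = ≤-trans (m≤m+n z z) 2z≤S
          len≤S′ = ≤-trans (n≤1+n _) len≤S
          ds₁ , value₁ , len₁ , r₁ = squareᵣ (record blank { loc = k ; siz = z ; dep = d ; mul = k }) (1b ∷ []) 2k≤S
            (≤-trans (s≤s (m≤m+n (k + k) z)) len≤S′)
          ds₂ , value₂ , len₂ , r₂ = multiplyᵣ (record blank { loc = k ; dep = d ; mul = z }) ds₁ 2z≤S
            (≤-trans (+-monoˡ-≤ z len₁) len≤S′)
      in 0b ∷ ds₂ , cong (_* 2) (trans value₂ (cong (z *_) value₁)) , s≤s (≤-trans len₂ (+-monoˡ-≤ z len₁)) ,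
         copyᵣ k refl refl refl refl k≤S ⨾ᵣ r₁ ⨾ᵣ clearᵣ k refl refl k≤S ⨾ᵣ
         moveOnesᵣ z refl refl z≤S ⨾ᵣ r₂ ⨾ᵣ clearᵣ z refl refl z≤S ⨾ᵣ pushᵣ

module Computation {P : Set} (countable : P ↣ ℕ) where
  open Encoding countable

  tables : OCP P → List Symbol
  tables 𝒪 =
    concatMap (λ q → subset (δ₀ q stay) ++ subset (δ₀ q up)) (allFin k) ++
    concatMap (λ q → subset (δ₊ q down) ++ subset (δ₊ q stay) ++ subset (δ₊ q up)) (allFin k) ++
    concatMap (λ p → name p ++ subset (label p)) support
    where open OCP 𝒪

  instance-of≡ : ∀ 𝒪 φ → instance-of (𝒪 , φ) ≡ ones (OCP.k 𝒪) ++ # ∷ tables 𝒪 ++ $ ∷ ctl φ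
  instance-of≡ 𝒪 φ = trans (++-assoc (ones k) _ (ctl φ)) (cong (λ u → ones k ++ # ∷ u)
    (trans (cong (_++ ctl φ) (trans (cong (A ++_) (sym (++-assoc B C ($ ∷ []))))
        (sym (++-assoc A (B ++ C) ($ ∷ [])))))
      (++-assoc (tables 𝒪) ($ ∷ []) (ctl φ))))
    where
    open OCP 𝒪
    A = concatMap (λ q → subset (δ₀ q stay) ++ subset (δ₀ q up)) (allFin k)
    B = concatMap (λ q → subset (δ₊ q down) ++ subset (δ₊ q stay) ++ subset (δ₊ q up)) (allFin k)
    C = concatMap (λ p → name p ++ subset (label p)) support

  private
    Not$ : Symbol → Set
    Not$ a = not$ (just a) ≡ true

    subset-not$ : ∀ {k} (A : Vec Bool k) → All Not$ (subset A)
    subset-not$ A = All.map⁺ (All.universal (λ _ → refl) (Vec.toList A))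

    name-not$ : ∀ p → All Not$ (name p)
    name-not$ p = All.++⁺ (All.map⁺ (All.universal (λ _ → refl) _)) (refl ∷ [])

    concatMap-not$ : ∀ {X : Set} (f : X → List Symbol) → (∀ x → All Not$ (f x)) → ∀ xs → All Not$ (concatMap f xs)
    concatMap-not$ f fs xs = All.concat⁺ (All.map⁺ (All.universal fs xs))

    tables-not$ : ∀ 𝒪 → All Not$ (tables 𝒪)
    tables-not$ 𝒪 = All.++⁺
      (concatMap-not$ _ (λ q → All.++⁺ (subset-not$ (δ₀ q stay)) (subset-not$ (δ₀ q up))) (allFin k))
      (All.++⁺
        (concatMap-not$ _ (λ q → All.++⁺ (subset-not$ (δ₊ q down))
          (All.++⁺ (subset-not$ (δ₊ q stay)) (subset-not$ (δ₊ q up)))) (allFin k))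
        (concatMap-not$ _ (λ p → All.++⁺ (name-not$ p) (subset-not$ (label p))) support))
      where open OCP 𝒪

  size≤length : ∀ φ → size φ ≤ length (ctl φ)
  size≤length (atom p)   = s≤s z≤n
  size≤length (¬′ φ)     = ≤-trans (≤-reflexive (+-comm (size φ) 1)) (s≤s (size≤length φ))
  size≤length (EX φ)     = ≤-trans (≤-reflexive (+-comm (size φ) 1)) (s≤s (size≤length φ))
  size≤length (φ ∧′ ψ)   = ≤-trans (≤-reflexive (+-comm (size φ + size ψ) 1))
    (s≤s (≤-trans (+-mono-≤ (size≤length φ) (size≤length ψ)) (≤-reflexive (sym (length-++ (ctl φ))))))
  size≤length (E φ U ψ)  = ≤-trans (≤-reflexive (+-comm (size φ + size ψ) 1))
    (s≤s (≤-trans (+-mono-≤ (size≤length φ) (size≤length ψ)) (≤-reflexive (sym (length-++ (ctl φ))))))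
  size≤length (E φ WU ψ) = ≤-trans (≤-reflexive (+-comm (size φ + size ψ) 1))
    (s≤s (≤-trans (+-mono-≤ (size≤length φ) (size≤length ψ)) (≤-reflexive (sym (length-++ (ctl φ))))))

  lud≤size : ∀ (φ : CTL P) → lud φ ≤ size φ
  lud≤size (atom p)   = z≤n
  lud≤size (¬′ φ)     = ≤-trans (lud≤size φ) (m≤m+n (size φ) 1)
  lud≤size (EX φ)     = ≤-trans (lud≤size φ) (m≤m+n (size φ) 1)
  lud≤size (φ ∧′ ψ)   = ⊔-lub (≤-trans (lud≤size φ) (≤-trans (m≤m+n (size φ) (size ψ)) (m≤m+n _ 1)))
                              (≤-trans (lud≤size ψ) (≤-trans (m≤n+m (size ψ) (size φ)) (m≤m+n _ 1)))
  lud≤size (E φ U ψ)  = ⊔-lub (+-monoˡ-≤ 1 (≤-trans (lud≤size φ) (m≤m+n (size φ) (size ψ))))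
                              (≤-trans (lud≤size ψ) (≤-trans (m≤n+m (size ψ) (size φ)) (m≤m+n _ 1)))
  lud≤size (E φ WU ψ) = ⊔-lub (+-monoˡ-≤ 1 (≤-trans (lud≤size φ) (m≤m+n (size φ) (size ψ))))
                              (≤-trans (lud≤size ψ) (≤-trans (m≤n+m (size ψ) (size φ)) (m≤m+n _ 1)))

  module _ (𝒪 : OCP P) (φ : CTL P) where
    open OCP 𝒪 using (k)

    private
      N = length (instance-of (𝒪 , φ))
      z = size φ + 0
      d = lud φ

      N≡ : N ≡ k + suc (length (tables 𝒪) + suc (length (ctl φ)))
      N≡ = trans (cong length (instance-of≡ 𝒪 φ)) (trans (length-++ (ones k))
        (cong₂ (λ a b → a + suc b) (Macros.length-ones 3 ≤-refl {17} k) (length-++ (tables 𝒪))))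

      ≤N : ∀ {m} → m ≤ k + suc (length (tables 𝒪) + suc (length (ctl φ))) → m ≤ N
      ≤N = subst (_ ≤_) (sym N≡)

      k≤N : k ≤ N
      k≤N = ≤N (m≤m+n k _)
      tables≤N : suc (length (tables 𝒪)) ≤ N
      tables≤N = ≤N (≤-trans (s≤s (m≤m+n (length (tables 𝒪)) _)) (m≤n+m _ k))
      ctl≤N : length (ctl φ) ≤ N
      ctl≤N = ≤N (≤-trans (n≤1+n _) (≤-trans (m≤n+m _ (length (tables 𝒪))) (≤-trans (n≤1+n _) (m≤n+m _ k))))
      size≤N : size φ ≤ N
      size≤N = ≤-trans (size≤length φ) ctl≤N
      z≤N : z ≤ N
      z≤N = subst (_≤ N) (sym (+-identityʳ (size φ))) size≤N
      d≤N : d ≤ N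
      d≤N = ≤-trans (lud≤size φ) size≤N

      -- The cubic term comes from the digits of the result: k rounds of d multiplications, each
      -- adding at most k digits, where k and d are at most `N`. The offset 3 covers the lower terms
      -- and gives `3 ≤ S`.
      S : ℕ
      S = (N + 3) ^ 3

      cube : ∀ n → (n + 3) * ((n + 3) * ((n + 3) * 1)) ≡
                   2 + (n + n + n) + n * (n * n) + (9 * (n * n) + 24 * n + 25)
      cube = solve-∀
      cube′ : ∀ n → (n + 3) * ((n + 3) * ((n + 3) * 1)) ≡
                    n * (1 + n) + (n * (n * n) + 8 * (n * n) + 26 * n + 27)
      cube′ = solve-∀

      main≤S : 2 + (N + N + N) + N * (N * N) ≤ S
      main≤S = ≤-trans (m≤m+n _ (9 * (N * N) + 24 * N + 25)) (≤-reflexive (sym (cube N)))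
      linear≤S : 2 + (N + N + N) ≤ S
      linear≤S = ≤-trans (m≤m+n _ (N * (N * N))) main≤S
      double≤S : N + N ≤ S
      double≤S = ≤-trans (m≤m+n (N + N) N) (≤-trans (m≤n+m _ 2) linear≤S)
      N≤S : N ≤ S
      N≤S = ≤-trans (m≤m+n N N) double≤S
      square≤S : N * suc N ≤ S
      square≤S = ≤-trans (m≤m+n _ (N * (N * N) + 8 * (N * N) + 26 * N + 27)) (≤-reflexive (sym (cube′ N)))
      3≤S : 3 ≤ S
      3≤S = ≤-trans (m≤n+m 3 N) (m≤m*n (N + 3) _ {{m^n≢0 (N + 3) 2 {{>-nonZero (≤-trans (s≤s z≤n) (m≤n+m 3 N))}}}})

      open Running S 3≤S {17}
      open Macros S 3≤S {17}
      open Factors S 3≤S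
      open Scaling S 3≤S
      open Reading S 3≤S countable

      start : Store
      start = record blank { inp = ones k ++ # ∷ tables 𝒪 ++ $ ∷ ctl φ }

      skipTablesᵣ : Runs skipTables ⟪ record blank { loc = k ; inp = # ∷ tables 𝒪 ++ $ ∷ ctl φ } ⟫
                                    ⟪ reading k (ctl φ) [] 0 0 ⟫
      skipTablesᵣ = whileᵣ (popsᵣ (record blank { loc = k }) (# ∷ tables 𝒪) ($ ∷ ctl φ) (refl ∷ tables-not$ 𝒪))
        refl (≤-trans tables≤N N≤S) ⨾ᵣ popᵣ

      parse : Rounds INP nonEmpty (branch INP token) (size φ)
                ⟪ reading k (ctl φ) (# ∷ []) 0 0 ⟫ ⟪ reading k [] [] z d ⟫
      parse = subst
        (λ u → Rounds INP nonEmpty (branch INP token) (size φ) ⟪ reading k u (# ∷ []) 0 0 ⟫ ⟪ reading k [] [] z d ⟫)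
        (++-identityʳ (ctl φ)) (formulaᵣ φ k [] 0 [] 0 0 (≤-trans ctl≤N N≤S) (≤-trans d≤N N≤S))

      computed : ∃[ ms ] ∃[ ds ] fromDigits ds ≡ threshold 𝒪 φ × Runs compute ⟪ start ⟫ ⟪ main 0 d k ms ds ⟫
      computed =
        let k≤S = ≤-trans k≤N N≤S
            2k≤S = ≤-trans (+-mono-≤ k≤N k≤N) double≤S
            3N = s≤s (s≤s (+-mono-≤ (+-mono-≤ k≤N k≤N) z≤N))
            ds₁ , value₁ , len₁ , r = scaleᵣ k z d 2k≤S (≤-trans (+-mono-≤ z≤N z≤N) double≤S) (≤-trans 3N linear≤S)
            ms , ds , value , rs = locationsᵣ k d 0 [] ds₁ k (fromDigits ds₁) refl refl 2k≤S (≤-trans d≤N N≤S)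
              (≤-trans (*-mono-≤ k≤N (s≤s k≤N)) square≤S)
              (≤-trans (+-mono-≤ (≤-trans len₁ 3N) (*-mono-≤ k≤N (*-mono-≤ d≤N k≤N))) main≤S)
              (sym (trans (cong (fromDigits ds₁ *_) (^-zeroˡ d)) (*-identityʳ (fromDigits ds₁))))
        in ms , ds ,
           trans value (trans (cong (_* lcmUpTo k ^ d) value₁) (rearrange (size φ) k (lcmUpTo k ^ d))) ,
           moveOnesᵣ k refl refl k≤S ⨾ᵣ skipTablesᵣ ⨾ᵣ
           pushᵣ ⨾ᵣ whileᵣ parse refl (≤-trans size≤N N≤S) ⨾ᵣ
           pushᵣ ⨾ᵣ r ⨾ᵣ whileᵣ rs refl k≤S
        where
        rearrange : ∀ s k x → (s + 0) * (k * (k * 1)) * 2 * x ≡ 2 * s * (k * (k * 1)) * x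
        rearrange = solve-∀

    polynomial : ∃[ n ] Σ (Stacks 17) λ τ → Σ (Expansion 2) λ ds →
      ⟨ compute , instance-of (𝒪 , φ) ∷ Vec.replicate 16 [] ⟩⇓[ n ] τ ×
      n ≤ 4 ^ (3 * degree compute) * N ^ (3 * degree compute) + 4 ^ (3 * degree compute) ×
      Vec.head τ ≡ map bit ds × fromDigits ds ≡ threshold 𝒪 φ
    polynomial =
      let ms , ds , value , runs n run n≤ = computed
          τ = ⟪ main 0 d k ms ds ⟫
      in n , τ , ds ,
         subst (λ u → ⟨ compute , u ∷ Vec.replicate 16 [] ⟩⇓[ n ] τ) (sym (instance-of≡ 𝒪 φ)) run ,
         ≤-trans n≤ bound , refl , value
      where
      e = 3 * degree compute
      1≤N : 1 ≤ N
      1≤N = ≤-trans (s≤s z≤n) tables≤N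
      -- The input is not empty, so N + 3 ≤ 4 N; this turns a power of `N + 3` into the required
      -- constant times a power of `N`.
      bound : S ^ degree compute ≤ 4 ^ e * N ^ e + 4 ^ e
      bound = ≤-trans (≤-reflexive (^-*-assoc (N + 3) 3 (degree compute)))
        (≤-trans (^-monoˡ-≤ e (≤-trans (+-monoʳ-≤ N (*-monoʳ-≤ 3 1≤N)) (≤-reflexive refl)))
        (≤-trans (≤-reflexive (^-distribʳ-* e 4 N)) (m≤m+n _ _)))

theorem1 : ∀ {P : Set} (countable : P ↣ ℕ) →
    Σ (OCP P → CTL P → ℕ) λ t →
    PolynomialTime (Encoding.instance-of countable) (uncurry t) ×
    (∀ (𝒪 : OCP P) (φ : CTL P) → let open OCP 𝒪 in
    t 𝒪 φ ≤ 2 * size φ * k ^ 2 * period 𝒪 φ ×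
    (∀ (n n′ : ℕ) → n > t 𝒪 φ → n′ > t 𝒪 φ → n ≡ n′ [mod period 𝒪 φ ] →
    ∀ (q : Q) → ⟦ T 𝒪 ⟧-in φ (q , n) ⇔ ⟦ T 𝒪 ⟧-in φ (q , n′)))
theorem1 countable =
  threshold ,
  (16 , compute , 4 ^ (3 * degree compute) , 3 * degree compute ,
    λ (𝒪 , φ) → Computation.polynomial countable 𝒪 φ) ,
  λ 𝒪 φ → ≤-refl , λ n n′ n>t n′>t n≡n′ q →
    -- The location `q` itself shows that `k` is nonzero; with no location there is nothing to
    -- prove.
    periodic⇒invariant 𝒪 {{Fin.nonZeroIndex q}} (periodic 𝒪 {{Fin.nonZeroIndex q}} φ) n>t n′>t n≡n′ q
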